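{- Let $B_{\mathrm{lbl}}(x,y)=\sum_{i,j\ge0}2^{ij}\frac{x^iy^j}{i!\,j!}$, the exponential generating function for labelled bicoloured graphs, and let $T_{\mathrm{lbl}}(x,y)=\sum_{i,j\ge0}\tau_{i,j}\frac{x^iy^j}{i!\,j!}$, where $\tau_{i,j}$ is the number of edge sets $E\subseteq V_1\times V_2$ with $V_1=\{u_1,\dots,u_i\}$, $V_2=\{w_1,\dots,w_j\}$ fixed labelled sets such that $(V_1,V_2,E)$ is a tangle. Then \[T_{\mathrm{lbl}}(x,y)=e^{ -x}+e^{ -y}-1-B_{\mathrm{lbl}}(x,y)^{ -1}.\]
   Context: A bicoloured graph is a triple $G=(V_1,V_2,E)$ with $V_1,V_2$ disjoint finite sets (ordered colour classes) and $E\subseteq V_1\times V_2$. For a vertex $u$ let $N(u)$ be its set of neighbours. $G$ is called a tangle if $|V_1|\ge2$, $|V_2|\ge2$, the graph on $V_2$ joining $a,b$ whenever neither of $N(a),N(b)$ contains the other is connected, and the graph on $V_1$ defined by the same rule is connected. (Equivalently, viewing $G$ as the poset on $V_1\cup V_2$ with $u<w$ iff $u\in V_1,w\in V_2$, $(u,w)\in E$, the whole poset is a single tangle with top $V_2$ and bottom $V_1$.) -}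

module Defs where

open import Data.Bool.Base using (Bool; true; false)
open import Data.Fin.Base using (Fin; toℕ)
open import Data.Fin.Properties using (all?; _≟_)
open import Data.Fin.Subset using (Subset; _⊆_)
open import Data.Fin.Subset.Properties using (_⊆?_)
open import Data.Integer.Base as ℤ using (ℤ; +_; -1ℤ; 0ℤ)
open import Data.List.Base using (List; []; _∷_; length; filter; cartesianProductWith; allFin)
open import Data.List.Membership.Propositional using (_∈_)
open import Data.List.Membership.Propositional.Properties using (∈-cartesianProductWith⁺; ∈-allFin)
open import Data.List.Relation.Unary.All as All using ()
open import Data.List.Relation.Unary.Any using (here; there)
open import Data.List.Relation.Unary.AllPairs using ([]; _∷_)
open import Data.List.Relation.Unary.Unique.Propositional using (Unique)
open import Data.List.Relation.Unary.Unique.Propositional.Properties using (cartesianProductWith⁺)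
open import Data.Nat.Base as ℕ using (ℕ; zero; suc; _∸_; _!)
open import Data.Nat.Properties as ℕ using (_!*_!≢0)
open import Data.Product.Base using (_×_; _,_)
open import Data.Rational.Base using (ℚ; _/_; _+_; _*_; _-_; 0ℚ; 1ℚ)
open import Data.Rational.Properties using (+-0-monoid)
open import Data.Sum.Base using (_⊎_; inj₁; inj₂)
open import Data.Vec.Base as Vec using (Vec; []; _∷_; lookup)
open import Data.Vec.Properties using (∷-injective)
open import Relation.Binary.Construct.Closure.ReflexiveTransitive using (Star; ε; _◅_; _◅◅_)
open import Level using (0ℓ)
open import Relation.Binary.Core using (Rel)
open import Relation.Binary.Definitions using (Decidable)
open import Relation.Binary.PropositionalEquality.Core using (_≡_; refl)
open import Relation.Nullary.Decidable using (Dec; map′; ¬?; _×-dec_; _⊎-dec_)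
open import Relation.Nullary.Negation using (¬_)
open import Algebra.Properties.Monoid.Sum +-0-monoid using (sum⁺-syntax)

-- An edge set E ⊆ V₁ × V₂ with V₁ = Fin i and V₂ = Fin j: the u-th entry
-- is the set of all w with (u , w) ∈ E.
EdgeSet : ℕ → ℕ → Set
EdgeSet i j = Vec (Subset j) i

N₁ : ∀ {i j} → EdgeSet i j → Fin i → Subset j
N₁ E u = lookup E u

N₂ : ∀ {i j} → EdgeSet i j → Fin j → Subset i
N₂ E w = Vec.map (λ row → lookup row w) E

Incomparable : ∀ {m n} → (Fin n → Subset m) → Rel (Fin n) 0ℓ
Incomparable N a b = ¬ (N a ⊆ N b) × ¬ (N b ⊆ N a)

-- Only used for symmetric R, where directed and undirected paths agree.
Connected : ∀ {n} → Rel (Fin n) 0ℓ → Set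
Connected R = ∀ a b → Star R a b

record IsTangle {i j : ℕ} (E : EdgeSet i j) : Set where
  constructor mkTangle
  field
    ∣V₁∣≥2 : 2 ℕ.≤ i
    ∣V₂∣≥2 : 2 ℕ.≤ j
    top-connected    : Connected (Incomparable (N₂ E))
    bottom-connected : Connected (Incomparable (N₁ E))

-- Reachability is decided by Warshall's algorithm: Via cs a b says that b
-- is reachable from a with all intermediate vertices taken from cs.
module _ {n : ℕ} (R : Rel (Fin n) 0ℓ) (R? : Decidable {A = Fin n} R) where

  Via : List (Fin n) → Rel (Fin n) 0ℓ
  Via []       a b = a ≡ b ⊎ R a b
  Via (c ∷ cs) a b = Via cs a b ⊎ (Via cs a c × Via cs c b)

  via? : ∀ cs → Decidable {A = Fin n} (Via cs)
  via? []       a b = (a ≟ b) ⊎-dec R? a b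
  via? (c ∷ cs) a b = via? cs a b ⊎-dec (via? cs a c ×-dec via? cs c b)

  via⇒star : ∀ cs {a b} → Via cs a b → Star R a b
  via⇒star []       (inj₁ refl)    = ε
  via⇒star []       (inj₂ r)       = r ◅ ε
  via⇒star (c ∷ cs) (inj₁ p)       = via⇒star cs p
  via⇒star (c ∷ cs) (inj₂ (p , q)) = via⇒star cs p ◅◅ via⇒star cs q

  base⇒via : ∀ cs {a b} → a ≡ b ⊎ R a b → Via cs a b
  base⇒via []       p = p
  base⇒via (c ∷ cs) p = inj₁ (base⇒via cs p)

  via-trans : ∀ {cs a b c} → c ∈ cs → Via cs a c → Via cs c b → Via cs a b
  via-trans (here refl) (inj₁ p)       (inj₁ q)       = inj₂ (p , q)
  via-trans (here refl) (inj₁ p)       (inj₂ (_ , q)) = inj₂ (p , q)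
  via-trans (here refl) (inj₂ (p , _)) (inj₁ q)       = inj₂ (p , q)
  via-trans (here refl) (inj₂ (p , _)) (inj₂ (_ , q)) = inj₂ (p , q)
  via-trans (there c∈)  (inj₁ p)       (inj₁ q)       = inj₁ (via-trans c∈ p q)
  via-trans (there c∈)  (inj₁ p)       (inj₂ (q , r)) = inj₂ (via-trans c∈ p q , r)
  via-trans (there c∈)  (inj₂ (p , q)) (inj₁ r)       = inj₂ (p , via-trans c∈ q r)
  via-trans (there c∈)  (inj₂ (p , _)) (inj₂ (_ , r)) = inj₂ (p , r)

  star⇒via : ∀ {a b} → Star R a b → Via (allFin n) a b
  star⇒via ε        = base⇒via (allFin n) (inj₁ refl)
  star⇒via (r ◅ rs) = via-trans (∈-allFin _) (base⇒via (allFin n) (inj₂ r)) (star⇒via rs)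

  connected? : Dec (Connected R)
  connected? = all? λ a → all? λ b →
    map′ (via⇒star (allFin n)) star⇒via (via? (allFin n) a b)

incomparable? : ∀ {m n} (N : Fin n → Subset m) → Decidable (Incomparable N)
incomparable? N a b = ¬? (N a ⊆? N b) ×-dec ¬? (N b ⊆? N a)

isTangle? : ∀ {i j} (E : EdgeSet i j) → Dec (IsTangle E)
isTangle? {i} {j} E = map′
  (λ (p , q , t , b) → mkTangle p q t b)
  (λ (mkTangle p q t b) → p , q , t , b)
  (2 ℕ.≤? i ×-dec 2 ℕ.≤? j
    ×-dec connected? _ (incomparable? (N₂ E))
    ×-dec connected? _ (incomparable? (N₁ E)))

vecsOver : ∀ {A : Set} → List A → ∀ n → List (Vec A n)
vecsOver xs zero    = [] ∷ []
vecsOver xs (suc n) = cartesianProductWith _∷_ xs (vecsOver xs n)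

vecsOver-complete : ∀ {A : Set} {xs : List A} → (∀ x → x ∈ xs) →
                    ∀ {n} (v : Vec A n) → v ∈ vecsOver xs n
vecsOver-complete all []      = here refl
vecsOver-complete all (x ∷ v) =
  ∈-cartesianProductWith⁺ _∷_ (all x) (vecsOver-complete all v)

vecsOver-unique : ∀ {A : Set} {xs : List A} → Unique xs →
                  ∀ n → Unique (vecsOver xs n)
vecsOver-unique xs! zero    = All.[] ∷ []
vecsOver-unique xs! (suc n) =
  cartesianProductWith⁺ _∷_ ∷-injective xs! (vecsOver-unique xs! n)

bools : List Bool
bools = true ∷ false ∷ []

edgeSets : ∀ i j → List (EdgeSet i j)
edgeSets i j = vecsOver (vecsOver bools j) i

edgeSets-complete : ∀ {i j} (E : EdgeSet i j) → E ∈ edgeSets i j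
edgeSets-complete = vecsOver-complete (vecsOver-complete λ where
  true  → here refl
  false → there (here refl))

edgeSets-unique : ∀ i j → Unique (edgeSets i j)
edgeSets-unique i j = vecsOver-unique (vecsOver-unique
  (((λ ()) All.∷ All.[]) ∷ All.[] ∷ []) j) i

τ : ℕ → ℕ → ℕ
τ i j = length (filter isTangle? (edgeSets i j))

-- f i j is the coefficient of xⁱ yʲ.
Series : Set
Series = ℕ → ℕ → ℚ

infix  4 _≈_
infixl 6 _⊕_ _⊖_
infixl 7 _⊛_

_≈_ : Series → Series → Set
f ≈ g = ∀ i j → f i j ≡ g i j

_⊕_ : Series → Series → Series
(f ⊕ g) i j = f i j + g i j

_⊖_ : Series → Series → Series
(f ⊖ g) i j = f i j - g i j

_⊛_ : Series → Series → Series
(f ⊛ g) i j = ∑[ a ≤ i ] ∑[ b ≤ j ] (f (toℕ a) (toℕ b) * g (i ∸ toℕ a) (j ∸ toℕ b))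

𝟙 : Series
𝟙 zero zero = 1ℚ
𝟙 _    _    = 0ℚ

egf : (ℕ → ℕ → ℤ) → Series
egf c i j = _/_ (c i j) (i ! ℕ.* j !) {{i !* j !≢0}}

exp[-x] : Series
exp[-x] = egf λ where
  i zero    → -1ℤ ℤ.^ i
  i (suc _) → 0ℤ

exp[-y] : Series
exp[-y] = egf λ where
  zero    j → -1ℤ ℤ.^ j
  (suc _) j → 0ℤ

B-lbl : Series
B-lbl = egf λ i j → + (2 ℕ.^ (i ℕ.* j))

T-lbl : Series
T-lbl = egf λ i j → + τ i j

-- Multiplication of series is commutative, so an inverse is two-sided and
-- unique up to _≈_.
_IsInverseOf_ : Series → Series → Set
g IsInverseOf f = f ⊛ g ≈ 𝟙

{-# OPTIONS --safe #-}

-- Call (A , C), with A ⊆ V₁ and C ⊆ V₂, a prefix of a graph if A is completely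
-- joined to V₂ ∖ C and no edge joins V₁ ∖ A to C.  A graph with a given prefix
-- is an arbitrary graph on (A , C) together with an arbitrary graph on the
-- complement, so the coefficient of xⁱyʲ in B·(e⁻ˣ + e⁻ʸ − 1 − T) is, up to
-- i!j!, the sum over all graphs of
--     Σ_{A : (A , ∅) prefix} (−1)^|A| + Σ_{C : (∅ , C) prefix} (−1)^|C| − 1
--       − #{prefixes inducing a tangle}.
-- The first sum is 1 unless some vertex of V₁ is joined to all of V₂, the second
-- is 1 unless some vertex of V₂ is isolated.  A graph is a tangle iff both classes
-- are non-empty and its only prefixes are the trivial ones; hence in a non-empty
-- graph without such special vertices a minimal non-empty prefix is the unique
-- prefix inducing a tangle, while special vertices exclude tangles and each
-- other.  So every non-empty graph contributes 0.
module Submission where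

open import Defs
open import Data.Bool.Base using (Bool; true; false; not; if_then_else_)
open import Data.Bool.Properties as Bool using (¬-not)
open import Data.Empty using (⊥-elim)
open import Data.Fin.Base using (Fin; zero; suc; toℕ; fromℕ; inject₁)
open import Data.Fin.Properties as Fin using (all?; any?; ∀-cons; toℕ-fromℕ; toℕ-inject₁; toℕ≤pred[n])
open import Data.Fin.Subset using (Subset; _⊆_; ∣_∣; ∁; ⊤; ⊥)
open import Data.Fin.Subset.Properties using (_⊆?_; anySubset?; ⊆-trans; ∣p∣≤n; ∣p∣≡n⇒p≡⊤; ∣⊥∣≡0)
open import Data.Integer.Base as ℤ using (ℤ; +_; 0ℤ; 1ℤ; -1ℤ)
open import Data.Integer.Properties as ℤ using ()
open import Data.Integer.Tactic.RingSolver using (solve-∀)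
open import Data.List.Base as List using (allFin; List; []; _∷_; _++_; length; filter; cartesianProductWith)
open import Data.Nat.Base as ℕ using (ℕ; zero; suc; s≤s; z≤n; _∸_; _!)
open import Data.Nat.Combinatorics using (nCk≡n!/k![n-k]!; k![n∸k]!∣n!; k>n⇒nCk≡0; nCk+nC[k+1]≡[n+1]C[k+1]) renaming (_C_ to _choose_)
open import Data.Nat.DivMod using (m/n*n≡m)
open import Data.Nat.Induction using (<-wellFounded)
open import Data.Nat.Properties as ℕ using (_!*_!≢0)
open import Data.Product.Base using (∃; ∃₂; _×_; _,_; proj₁; proj₂)
open import Data.Rational.Base as ℚ using (_/_; 0ℚ; fromℚᵘ)
open import Data.Rational.Properties as ℚ using (toℚᵘ-fromℚᵘ; fromℚᵘ-cong; toℚᵘ-homo-+; toℚᵘ-homo-*; toℚᵘ-homo‿-; toℚᵘ-injective)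
open import Data.Rational.Solver using (module +-*-Solver)
open import Data.Rational.Unnormalised.Base as ℚᵘ using (mkℚᵘ; *≡*)
open import Data.Rational.Unnormalised.Properties as ℚᵘ using ()
open import Data.Sum.Base using (_⊎_; inj₁; inj₂)
open import Data.Vec.Base as Vec using (Vec; []; _∷_; lookup; tabulate)
open import Data.Vec.Properties using ([]=⇒lookup; lookup⇒[]=; lookup-map; lookup∘tabulate; lookup-replicate; tabulate∘lookup; tabulate-cong; ∷-injectiveʳ)
open import Function.Base using (_∘_; const; case_of_)
open import Induction.WellFounded using (Acc; acc)
open import Relation.Binary.Construct.Closure.ReflexiveTransitive using (Star; ε; _◅_; _◅◅_)
open import Relation.Binary.PropositionalEquality
open import Relation.Nullary.Decidable using (Dec; does; yes; no; map′; ¬?; _×-dec_; _⊎-dec_; dec-true; dec-false; decidable-stable; _→-dec_)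
open import Relation.Nullary.Negation using (¬_; contradiction)
open import Algebra.Properties.Monoid.Sum ℤ.+-0-monoid using (sum; sum-cong-≗; sum-init-last)
open import Algebra.Properties.CommutativeMonoid.Sum ℤ.+-0-commutativeMonoid using (∑-distrib-+)
open import Algebra.Properties.Semiring.Sum ℤ.+-*-semiring using (*-distribˡ-sum)
import Algebra.Properties.Monoid.Sum ℚ.+-0-monoid as ℚ∑

private variable
  i j m n : ℕ
  X Y Z : Set
  P Q : Set

-- Connectedness and cuts

true≢false : ¬ (true ≡ false)
true≢false ()

does≡true⇒ : ∀ {P : Set} (P? : Dec P) → does P? ≡ true → P
does≡true⇒ (yes p) _ = p

does≡false⇒ : ∀ {P : Set} (P? : Dec P) → does P? ≡ false → ¬ P
does≡false⇒ (no ¬p) _ = ¬p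

-- No incomparable pair crosses such a bipartition, so connectedness means that only constant
-- bipartitions are cuts. In this dual form it can be compared with prefixes; the side with value
-- `true` is the upper one.
IsCut : (Fin n → Subset m) → (Fin n → Bool) → Set
IsCut N p = ∀ x y → p x ≡ true → p y ≡ false → N y ⊆ N x

cut-closed : {N : Fin n → Subset m} {p : Fin n → Bool} → IsCut N p →
             ∀ {x y} → Star (Incomparable N) x y → p x ≡ true → p y ≡ true
cut-closed cut ε px = px
cut-closed {p = p} cut (_◅_ {j = z} r rs) px with p z in pz
... | true  = cut-closed cut rs pz
... | false = ⊥-elim (proj₂ r (cut _ z px pz))

connected⇒cut-constant : {N : Fin n → Subset m} → Connected (Incomparable N) →
                         ∀ {p} → IsCut N p → ∀ x y → p x ≡ p y
connected⇒cut-constant conn {p} cut x y with p x in px | p y in py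
... | true  | true  = refl
... | false | false = refl
... | true  | false = trans (sym (cut-closed cut (conn x y) px)) py
... | false | true  = trans (sym px) (cut-closed cut (conn y x) py)

-- If the component of a is not everything, then every vertex outside it lies
-- above all of it or below all of it, and this yields a non-trivial cut.
cut-constant⇒connected : (N : Fin n → Subset m) →
                         (∀ p → IsCut N p → ∀ x y → p x ≡ p y) →
                         Connected (Incomparable N)
cut-constant⇒connected {n} N constant a b =
  decidable-stable (reach? b) λ a↛b → case any? (λ z → ¬? (reach? z) ×-dec ¬? (N a ⊆? N z)) of λ where
    -- Every vertex outside the component of `a` lies above `a`, hence by `down` above the whole
    -- component: the outside vertices form the upper side.
    (no none) →
      let p = λ x → not (does (reach? x))
          above : ∀ x → ¬ Reach x → N a ⊆ N x
          above x a↛x = decidable-stable (N a ⊆? N x) λ a⊈x → none (x , a↛x , a⊈x)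
          cut : IsCut N p
          cut x y px py =
            let a↛x = does≡false⇒ (reach? x) (Bool.not-injective px)
            in down a↛x ε (above x a↛x) (does≡true⇒ (reach? y) (Bool.not-injective py))
      in contradiction
           (trans (cong not (sym (dec-true (reach? a) ε)))
             (trans (constant p cut a b) (cong not (dec-false (reach? b) a↛b))))
           (λ ())
    -- The upper side is the component of `a` together with everything above `a`. A vertex in
    -- neither is comparable with `a` and not above it, so it lies below `a`; `z` is such a vertex.
    (yes (z , a↛z , a⊈z)) →
      let q? = λ x → reach? x ⊎-dec (N a ⊆? N x)
          p = λ x → does (q? x)
          cut : IsCut N p
          cut x y px py =
            let ¬qy = does≡false⇒ (q? y) py
                y⊆a = decidable-stable (N y ⊆? N a) λ y⊈a →
                        ¬qy (inj₁ ((¬qy ∘ inj₂ , y⊈a) ◅ ε))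
            in case does≡true⇒ (q? x) px of λ where
                 (inj₁ a→x) → up (¬qy ∘ inj₁) ε y⊆a a→x
                 (inj₂ a⊆x) → ⊆-trans y⊆a a⊆x
      in contradiction
           (trans (sym (dec-true (q? a) (inj₁ ε)))
             (trans (constant p cut a z)
               (dec-false (q? z) λ { (inj₁ a→z) → a↛z a→z ; (inj₂ a⊆z) → a⊈z a⊆z })))
           true≢false
  where
  R = Incomparable N
  R? = incomparable? N

  Reach : Fin n → Set
  Reach = Star R a

  reach? : ∀ x → Dec (Reach x)
  reach? x = map′ (via⇒star R R? (allFin n)) (star⇒via R R?) (via? R R? (allFin n) a x)

  -- A vertex outside the component is comparable with all of it. It cannot pass from below `k` to
  -- above the next vertex `k′` of the path, since then `k′` would lie below `k`.
  up : ∀ {z k l} → ¬ Reach z → Reach k → N z ⊆ N k → Star R k l → N z ⊆ N l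
  up a↛z a→k z⊆k ε = z⊆k
  up {z} a↛z a→k z⊆k (_◅_ {j = k′} r rs) = up a↛z (a→k ◅◅ (r ◅ ε))
    (decidable-stable (N z ⊆? N k′) λ z⊈k′ →
      a↛z (a→k ◅◅ (r ◅ ((λ k′⊆z → proj₂ r (⊆-trans k′⊆z z⊆k)) , z⊈k′) ◅ ε))) rs

  down : ∀ {z k l} → ¬ Reach z → Reach k → N k ⊆ N z → Star R k l → N l ⊆ N z
  down a↛z a→k k⊆z ε = k⊆z
  down {z} a↛z a→k k⊆z (_◅_ {j = k′} r rs) = down a↛z (a→k ◅◅ (r ◅ ε))
    (decidable-stable (N k′ ⊆? N z) λ k′⊈z →
      a↛z (a→k ◅◅ (r ◅ (k′⊈z , (λ z⊆k′ → proj₁ r (⊆-trans k⊆z z⊆k′))) ◅ ε))) rs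

-- Prefixes and tangles

edge : EdgeSet i j → Fin i → Fin j → Bool
edge E u w = lookup (lookup E u) w

-- The lower part (p , q) of a cut of the poset: p is completely joined to the
-- complement of q, and no edge joins the complement of p to q.
IsPrefix : EdgeSet i j → (Fin i → Bool) → (Fin j → Bool) → Set
IsPrefix E p q = ∀ u w → p u ≡ q w ⊎ edge E u w ≡ p u

-- The value `b` is shared by both classes, so exactly the empty and the full prefix are trivial;
-- one whole class alone is not.
Constant : (Fin i → Bool) → (Fin j → Bool) → Set
Constant p q = ∃ λ b → (∀ u → p u ≡ b) × (∀ w → q w ≡ b)

Indecomposable : EdgeSet i j → Set
Indecomposable E = ∀ p q → IsPrefix E p q → Constant p q

⊆⇒lookup : {P Q : Subset n} → P ⊆ Q → ∀ x → lookup P x ≡ true → lookup Q x ≡ true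
⊆⇒lookup P⊆Q x px = []=⇒lookup (P⊆Q (lookup⇒[]= x _ px))

lookup⇒⊆ : {P Q : Subset n} → (∀ x → lookup P x ≡ true → lookup Q x ≡ true) → P ⊆ Q
lookup⇒⊆ f {x} x∈P = lookup⇒[]= x _ (f x ([]=⇒lookup x∈P))

lookup-N₂ : (E : EdgeSet i j) → ∀ w u → lookup (N₂ E w) u ≡ edge E u w
lookup-N₂ E w u = lookup-map u (λ row → lookup row w) E

N₁⊆⇒ : (E : EdgeSet i j) → ∀ {u v} → N₁ E u ⊆ N₁ E v → ∀ w → edge E u w ≡ true → edge E v w ≡ true
N₁⊆⇒ E = ⊆⇒lookup

N₂⊆⇒ : (E : EdgeSet i j) → ∀ {w x} → N₂ E w ⊆ N₂ E x → ∀ u → edge E u w ≡ true → edge E u x ≡ true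
N₂⊆⇒ E w⊆x u e = trans (sym (lookup-N₂ E _ u)) (⊆⇒lookup w⊆x u (trans (lookup-N₂ E _ u) e))

⇒N₂⊆ : (E : EdgeSet i j) → ∀ {w x} → (∀ u → edge E u w ≡ true → edge E u x ≡ true) → N₂ E w ⊆ N₂ E x
⇒N₂⊆ E f = lookup⇒⊆ λ u e → trans (lookup-N₂ E _ u) (f u (trans (sym (lookup-N₂ E _ u)) e))

prefix⇒edge : (E : EdgeSet i j) → ∀ {p q} → IsPrefix E p q →
              ∀ {u w} → p u ≡ true → q w ≡ false → edge E u w ≡ true
prefix⇒edge E pre {u} {w} pu qw with pre u w
... | inj₁ pu≡qw = contradiction (trans (sym pu) (trans pu≡qw qw)) true≢false
... | inj₂ e     = trans e pu

prefix⇒nonedge : (E : EdgeSet i j) → ∀ {p q} → IsPrefix E p q →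
                 ∀ {u w} → p u ≡ false → q w ≡ true → edge E u w ≡ false
prefix⇒nonedge E pre {u} {w} pu qw with pre u w
... | inj₁ pu≡qw = contradiction (trans (sym qw) (trans (sym pu≡qw) pu)) true≢false
... | inj₂ e     = trans e pu

mkPrefix : (E : EdgeSet i j) → ∀ {p q} →
           (∀ u w → p u ≡ true → q w ≡ false → edge E u w ≡ true) →
           (∀ u w → p u ≡ false → q w ≡ true → edge E u w ≡ false) →
           IsPrefix E p q
mkPrefix E {p} {q} f g u w with p u in pu | q w in qw
... | true  | true  = inj₁ refl
... | false | false = inj₁ refl
... | true  | false = inj₂ (f u w pu qw)
... | false | true  = inj₂ (g u w pu qw)

-- For a prefix, `p` is a cut of the lower class and the complement of `q` a cut of the upper one,
-- so both are constant. If the constants differed, the graph would be complete or edgeless.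
tangle⇒indecomposable : {E : EdgeSet i j} → IsTangle E → Indecomposable E
tangle⇒indecomposable {E = E} (mkTangle (s≤s (s≤s _)) (s≤s (s≤s _)) top bottom) p q pre =
  case q zero Bool.≟ p zero of λ where
    (yes eq) → p zero , p-const , λ w → trans (q-const w) eq
    (no neq) →
      let e : ∀ u w → edge E u w ≡ p zero
          e u w = case pre u w of λ where
            (inj₁ pu≡qw) → contradiction (trans (sym (q-const w)) (trans (sym pu≡qw) (p-const u))) neq
            (inj₂ e)     → trans e (p-const u)
      -- A path between two distinct vertices has a first step, which joins incomparable
      -- neighbourhoods, but here all neighbourhoods coincide.
      in case bottom zero (suc zero) of λ where
           (_◅_ {j = v} r _) → ⊥-elim (proj₁ r
             (lookup⇒⊆ λ w e₀ → trans (trans (e v w) (sym (e zero w))) e₀))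
  where
  bottom-cut : IsCut (N₁ E) p
  bottom-cut u v pu pv = lookup⇒⊆ λ w evw → prefix⇒edge E pre pu
    (¬-not λ qw → contradiction (trans (sym evw) (prefix⇒nonedge E pre pv qw)) true≢false)

  top-cut : IsCut (N₂ E) (not ∘ q)
  top-cut w x qw qx = ⇒N₂⊆ E λ u eux → prefix⇒edge E pre
    (¬-not λ pu → contradiction (trans (sym eux) (prefix⇒nonedge E pre pu (Bool.not-injective qx))) true≢false)
    (Bool.not-injective qw)

  p-const : ∀ u → p u ≡ p zero
  p-const u = connected⇒cut-constant bottom bottom-cut u zero

  q-const : ∀ w → q w ≡ q zero
  q-const w = Bool.not-injective (connected⇒cut-constant top top-cut w zero)

-- If the lower class is a single vertex and `C` is its set of non-neighbours, then `C` forms a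
-- prefix both with and without that vertex. These cannot both be constant, since the upper class is
-- non-empty.
indecomposable⇒2≤i : {E : EdgeSet (suc i) (suc j)} → Indecomposable E → 2 ℕ.≤ suc i
indecomposable⇒2≤i {suc i} _ = s≤s (s≤s z≤n)
indecomposable⇒2≤i {zero} {E = E} ind
  with ind (const true) (not ∘ edge E zero)
           (mkPrefix E (λ { zero w _ → Bool.not-injective }) (λ _ _ ()))
     | ind (const false) (not ∘ edge E zero)
           (mkPrefix E (λ _ _ ()) (λ { zero w _ → Bool.not-injective }))
... | b , p≡b , q≡b | c , p≡c , q≡c =
  contradiction (trans (p≡b zero) (trans (sym (q≡b zero)) (trans (q≡c zero) (sym (p≡c zero))))) true≢false

-- The dual argument: the neighbours of a single upper vertex form a prefix both with and without
-- it.
indecomposable⇒2≤j : {E : EdgeSet (suc i) (suc j)} → Indecomposable E → 2 ℕ.≤ suc j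
indecomposable⇒2≤j {j = suc j} _ = s≤s (s≤s z≤n)
indecomposable⇒2≤j {j = zero} {E = E} ind
  with ind (λ u → edge E u zero) (const true)
           (mkPrefix E (λ _ _ _ ()) (λ { u zero e _ → e }))
     | ind (λ u → edge E u zero) (const false)
           (mkPrefix E (λ { u zero e _ → e }) (λ _ _ _ ()))
... | b , p≡b , q≡b | c , p≡c , q≡c =
  contradiction (trans (q≡b zero) (trans (sym (p≡b zero)) (trans (p≡c zero) (sym (q≡c zero))))) true≢false

-- Every cut of one class extends to a prefix by a suitable choice in the other class.
-- Indecomposability then makes the cut constant, which gives connectedness.
indecomposable⇒tangle : {E : EdgeSet i j} → Fin i → Fin j → Indecomposable E → IsTangle E
indecomposable⇒tangle {suc i} {suc j} {E} _ _ ind = mkTangle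
  (indecomposable⇒2≤i {E = E} ind) (indecomposable⇒2≤j {E = E} ind)
  (cut-constant⇒connected (N₂ E) top) (cut-constant⇒connected (N₁ E) bottom)
  where
  bottom : ∀ p → IsCut (N₁ E) p → ∀ x y → p x ≡ p y
  bottom p cut x y =
    -- The prefix takes those `w` that have no neighbour outside `p`. Any other `w` has a neighbour
    -- `v` outside `p`, and the cut passes this edge on to all of `p`.
    let q? = λ w → any? λ v → (p v Bool.≟ false) ×-dec (edge E v w Bool.≟ true)
        (b , p≡b , _) = ind p (λ w → not (does (q? w))) (mkPrefix E
          (λ u w pu qw → let (v , pv , evw) = does≡true⇒ (q? w) (Bool.not-injective qw)
                         in N₁⊆⇒ E {v} {u} (cut u v pu pv) w evw)
          (λ u w pu qw → ¬-not λ euw → does≡false⇒ (q? w) (Bool.not-injective qw) (u , pu , euw)))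
    in trans (p≡b x) (sym (p≡b y))

  top : ∀ q → IsCut (N₂ E) q → ∀ x y → q x ≡ q y
  top q cut x y =
    -- The prefix takes those `u` that are joined to the whole upper side of the cut. Any other `u`
    -- misses some upper `x`, hence misses everything below `x`.
    let p? = λ u → any? λ w → (q w Bool.≟ true) ×-dec (edge E u w Bool.≟ false)
        (b , _ , q≡b) = ind (λ u → not (does (p? u))) (not ∘ q) (mkPrefix E
          (λ u w pu qw → ¬-not λ euw →
             does≡false⇒ (p? u) (Bool.not-injective pu) (w , Bool.not-injective qw , euw))
          (λ u w pu qw → let (x , qx , eux) = does≡true⇒ (p? u) (Bool.not-injective pu)
                         in ¬-not λ euw → contradiction
                              (trans (sym (N₂⊆⇒ E {w} {x} (cut x w qx (Bool.not-injective qw)) u euw)) eux)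
                              true≢false))
    in Bool.not-injective (trans (q≡b x) (sym (q≡b y)))

-- Induced subgraphs

embed : (A : Subset n) → Fin ∣ A ∣ → Fin n
embed (true  ∷ A) zero    = zero
embed (true  ∷ A) (suc x) = suc (embed A x)
embed (false ∷ A) x       = suc (embed A x)

restrict : (A : Subset n) → Vec X n → Vec X ∣ A ∣
restrict []          []      = []
restrict (true  ∷ A) (x ∷ v) = x ∷ restrict A v
restrict (false ∷ A) (x ∷ v) = restrict A v

induced : (A : Subset i) (C : Subset j) → EdgeSet i j → EdgeSet ∣ A ∣ ∣ C ∣
induced A C E = Vec.map (restrict C) (restrict A E)

lookup-restrict : (A : Subset n) (v : Vec X n) → ∀ x → lookup (restrict A v) x ≡ lookup v (embed A x)
lookup-restrict (true  ∷ A) (_ ∷ v) zero    = refl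
lookup-restrict (true  ∷ A) (_ ∷ v) (suc x) = lookup-restrict A v x
lookup-restrict (false ∷ A) (_ ∷ v) x       = lookup-restrict A v x

edge-induced : (A : Subset i) (C : Subset j) (E : EdgeSet i j) → ∀ u w →
               edge (induced A C E) u w ≡ edge E (embed A u) (embed C w)
edge-induced A C E u w = begin
  lookup (lookup (induced A C E) u) w            ≡⟨ cong (λ r → lookup r w) (lookup-map u (restrict C) (restrict A E)) ⟩
  lookup (restrict C (lookup (restrict A E) u)) w ≡⟨ lookup-restrict C _ w ⟩
  lookup (lookup (restrict A E) u) (embed C w)   ≡⟨ cong (λ r → lookup r (embed C w)) (lookup-restrict A E u) ⟩
  edge E (embed A u) (embed C w)                 ∎
  where open ≡-Reasoning

-- A view: matching on it replaces an element of `A` by its index in the induced graph.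
data InImage (A : Subset n) : Fin n → Set where
  embedded : ∀ x → InImage A (embed A x)

inImage : (A : Subset n) → ∀ {x} → lookup A x ≡ true → InImage A x
inImage (true  ∷ A) {zero}  _  = embedded zero
inImage (true  ∷ A) {suc x} x∈A with inImage A x∈A
... | embedded y = embedded (suc y)
inImage (false ∷ A) {suc x} x∈A with inImage A x∈A
... | embedded y = embedded y

lookup-embed : (A : Subset n) → ∀ x → lookup A (embed A x) ≡ true
lookup-embed (true  ∷ A) zero    = refl
lookup-embed (true  ∷ A) (suc x) = lookup-embed A x
lookup-embed (false ∷ A) x       = lookup-embed A x

extend : (A : Subset n) → Subset ∣ A ∣ → Subset n
extend []          P       = []
extend (true  ∷ A) (b ∷ P) = b ∷ extend A P
extend (false ∷ A) P       = false ∷ extend A P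

lookup-extend-embed : (A : Subset n) (P : Subset ∣ A ∣) → ∀ x → lookup (extend A P) (embed A x) ≡ lookup P x
lookup-extend-embed (true  ∷ A) (b ∷ P) zero    = refl
lookup-extend-embed (true  ∷ A) (b ∷ P) (suc x) = lookup-extend-embed A P x
lookup-extend-embed (false ∷ A) P       x       = lookup-extend-embed A P x

extend-⊆ : (A : Subset n) (P : Subset ∣ A ∣) → ∀ x → lookup (extend A P) x ≡ true → lookup A x ≡ true
extend-⊆ (true  ∷ A) (b ∷ P) zero    _ = refl
extend-⊆ (true  ∷ A) (b ∷ P) (suc x) h = extend-⊆ A P x h
extend-⊆ (false ∷ A) P       (suc x) h = extend-⊆ A P x h

∣extend∣ : (A : Subset n) (P : Subset ∣ A ∣) → ∣ extend A P ∣ ≡ ∣ P ∣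
∣extend∣ []          []          = refl
∣extend∣ (true  ∷ A) (true  ∷ P) = cong suc (∣extend∣ A P)
∣extend∣ (true  ∷ A) (false ∷ P) = ∣extend∣ A P
∣extend∣ (false ∷ A) P           = ∣extend∣ A P

subset-ext : {P Q : Subset n} → (∀ x → lookup P x ≡ lookup Q x) → P ≡ Q
subset-ext {P = P} {Q} h = trans (sym (tabulate∘lookup P)) (trans (tabulate-cong h) (tabulate∘lookup Q))

lookup-false⇒∣p∣<n : (P : Subset n) → ∀ x → lookup P x ≡ false → ∣ P ∣ ℕ.< n
lookup-false⇒∣p∣<n P x Px = ℕ.≤∧≢⇒< (∣p∣≤n P) λ eq → contradiction
  (trans (sym (lookup-replicate x true)) (trans (cong (λ Q → lookup Q x) (sym (∣p∣≡n⇒p≡⊤ {p = P} eq))) Px)) true≢false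

Prefix : EdgeSet i j → Subset i → Subset j → Set
Prefix E A C = IsPrefix E (lookup A) (lookup C)

isPrefix? : (E : EdgeSet i j) → ∀ p q → Dec (IsPrefix E p q)
isPrefix? E p q = all? λ u → all? λ w → (p u Bool.≟ q w) ⊎-dec (edge E u w Bool.≟ p u)

constant? : (p : Fin i → Bool) (q : Fin j → Bool) → Dec (Constant p q)
constant? p q = map′
  (λ { (inj₁ h) → true , h ; (inj₂ h) → false , h })
  (λ { (true , h) → inj₁ h ; (false , h) → inj₂ h })
  (const? true ⊎-dec const? false)
  where
  const? : ∀ b → Dec ((∀ u → p u ≡ b) × (∀ w → q w ≡ b))
  const? b = all? (λ u → p u Bool.≟ b) ×-dec all? (λ w → q w Bool.≟ b)

prefix-restrict : (E : EdgeSet i j) (A : Subset i) (C : Subset j) → ∀ {p q} →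
                  IsPrefix E p q → IsPrefix (induced A C E) (p ∘ embed A) (q ∘ embed C)
prefix-restrict E A C pre u w with pre (embed A u) (embed C w)
... | inj₁ eq = inj₁ eq
... | inj₂ eq = inj₂ (trans (edge-induced A C E u w) eq)

-- The extended sets stay inside `A` and `C`, so pairs leaving `A` or `C` are decided by the outer
-- prefix; all other pairs lie in the induced graph and are decided by the inner one.
prefix-extend : (E : EdgeSet i j) (A : Subset i) (C : Subset j) → ∀ {P Q} →
                Prefix E A C → Prefix (induced A C E) P Q → Prefix E (extend A P) (extend C Q)
prefix-extend E A C {P} {Q} pre pre′ = mkPrefix E full empty
  where
  full : ∀ u w → lookup (extend A P) u ≡ true → lookup (extend C Q) w ≡ false → edge E u w ≡ true
  full u w hu hw with lookup C w in w∈C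
  ... | false = prefix⇒edge E pre (extend-⊆ A P u hu) w∈C
  ... | true  with inImage A (extend-⊆ A P u hu) | inImage C w∈C
  ...   | embedded u′ | embedded w′ = trans (sym (edge-induced A C E u′ w′))
          (prefix⇒edge (induced A C E) pre′ (trans (sym (lookup-extend-embed A P u′)) hu)
                                            (trans (sym (lookup-extend-embed C Q w′)) hw))

  empty : ∀ u w → lookup (extend A P) u ≡ false → lookup (extend C Q) w ≡ true → edge E u w ≡ false
  empty u w hu hw with lookup A u in u∈A
  ... | false = prefix⇒nonedge E pre u∈A (extend-⊆ C Q w hw)
  ... | true  with inImage A u∈A | inImage C (extend-⊆ C Q w hw)
  ...   | embedded u′ | embedded w′ = trans (sym (edge-induced A C E u′ w′))
          (prefix⇒nonedge (induced A C E) pre′ (trans (sym (lookup-extend-embed A P u′)) hu)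
                                               (trans (sym (lookup-extend-embed C Q w′)) hw))

-- Tangle prefixes

TanglePrefix : EdgeSet i j → Subset i → Subset j → Set
TanglePrefix E A C = Prefix E A C × IsTangle (induced A C E)

FullRow : EdgeSet i j → Fin i → Set
FullRow E u = ∀ w → edge E u w ≡ true

EmptyColumn : EdgeSet i j → Fin j → Set
EmptyColumn E w = ∀ u → edge E u w ≡ false

tangle-vertices : {E : EdgeSet i j} → IsTangle E → Fin i × Fin j
tangle-vertices (mkTangle (s≤s _) (s≤s _) _ _) = zero , zero

-- The trace of a prefix of E on the induced tangle is a prefix, hence trivial;
-- here this is applied to ({u} , ∅).
fullRow⇒¬tanglePrefix : {E : EdgeSet i j} → ∀ {u} → FullRow E u → ∀ {A C} → ¬ TanglePrefix E A C
fullRow⇒¬tanglePrefix {i = i} {E = E} {u} row {A} {C} (pre , tangle)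
  with tangle⇒indecomposable tangle _ _
         (prefix-restrict E A C {λ x → does (x Fin.≟ u)} {const false}
           (mkPrefix E (λ x w x≡u _ → subst (λ y → edge E y w ≡ true) (sym (does≡true⇒ (x Fin.≟ u) x≡u)) (row w))
                       (λ _ _ _ ())))
     | tangle-vertices tangle
... | b , p≡b , q≡b | _ , w =
  contradiction (trans (sym (row (embed C w))) (prefix⇒nonedge E pre u∉A (lookup-embed C w))) true≢false
  where
  u∉A : lookup A u ≡ false
  u∉A = ¬-not λ u∈A → case inImage A u∈A of λ where
    (embedded x) → contradiction
      (trans (sym (dec-true (embed A x Fin.≟ embed A x) refl)) (trans (p≡b x) (sym (q≡b w)))) true≢false

-- The dual argument with the prefix (∅ , {w}): its trace is empty, so `w` lies outside `C` and is
-- joined to all of the non-empty `A`.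
emptyColumn⇒¬tanglePrefix : {E : EdgeSet i j} → ∀ {w} → EmptyColumn E w → ∀ {A C} → ¬ TanglePrefix E A C
emptyColumn⇒¬tanglePrefix {E = E} {w} column {A} {C} (pre , tangle)
  with tangle⇒indecomposable tangle _ _
         (prefix-restrict E A C {const false} {λ x → does (x Fin.≟ w)}
           (mkPrefix E (λ _ _ ())
                       (λ u x _ x≡w → subst (λ y → edge E u y ≡ false) (sym (does≡true⇒ (x Fin.≟ w) x≡w)) (column u))))
     | tangle-vertices tangle
... | b , p≡b , q≡b | u , _ =
  contradiction (trans (sym (prefix⇒edge E pre (lookup-embed A u) w∉C)) (column (embed A u))) true≢false
  where
  w∉C : lookup C w ≡ false
  w∉C = ¬-not λ w∈C → case inImage C w∈C of λ where
    (embedded x) → contradiction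
      (trans (sym (dec-true (embed C x Fin.≟ embed C x) refl)) (trans (q≡b x) (sym (p≡b u)))) true≢false

-- The trace of the second prefix on the first tangle is full or empty. If it is empty, take `u` in
-- `A` and `w` in `C′`: the first prefix requires an edge between them and the second forbids it.
tanglePrefix-⊆ : (E : EdgeSet i j) → ∀ {A C A′ C′} → TanglePrefix E A C → TanglePrefix E A′ C′ →
                 (∀ u → lookup A u ≡ true → lookup A′ u ≡ true) ×
                 (∀ w → lookup C w ≡ true → lookup C′ w ≡ true)
tanglePrefix-⊆ E {A} {C} {A′} {C′} (pre , tangle) (pre′ , tangle′)
  with tangle⇒indecomposable tangle _ _ (prefix-restrict E A C pre′)
... | true , p≡b , q≡b = (λ u u∈A → case inImage A u∈A of λ { (embedded x) → p≡b x }) ,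
                         (λ w w∈C → case inImage C w∈C of λ { (embedded x) → q≡b x })
... | false , p≡b , q≡b
  with tangle-vertices tangle | tangle-vertices tangle′
...   | u , _ | _ , w = contradiction
  (trans (sym (prefix⇒edge E pre (lookup-embed A u) w∉C))
         (prefix⇒nonedge E pre′ (p≡b u) (lookup-embed C′ w)))
  true≢false
  where
  w∉C : lookup C (embed C′ w) ≡ false
  w∉C = ¬-not λ w∈C → contradiction (lookup-embed C′ w) (out w∈C)
    where
    out : ∀ {x} → lookup C x ≡ true → ¬ (lookup C′ x ≡ true)
    out x∈C x∈C′ with inImage C x∈C
    ... | embedded y = contradiction (trans (sym x∈C′) (q≡b y)) true≢false

tanglePrefix-unique : (E : EdgeSet i j) → ∀ {A C A′ C′} → TanglePrefix E A C → TanglePrefix E A′ C′ →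
                      A ≡ A′ × C ≡ C′
tanglePrefix-unique E {A} {C} {A′} {C′} t t′ =
  subset-ext (λ u → iff⇒≡ (proj₁ (tanglePrefix-⊆ E {A} {C} {A′} {C′} t t′) u) (proj₁ (tanglePrefix-⊆ E {A′} {C′} {A} {C} t′ t) u)) ,
  subset-ext (λ w → iff⇒≡ (proj₂ (tanglePrefix-⊆ E {A} {C} {A′} {C′} t t′) w) (proj₂ (tanglePrefix-⊆ E {A′} {C′} {A} {C} t′ t) w))
  where
  iff⇒≡ : ∀ {a b} → (a ≡ true → b ≡ true) → (b ≡ true → a ≡ true) → a ≡ b
  iff⇒≡ {true}  {b}     f _ = sym (f refl)
  iff⇒≡ {false} {true}  _ g = g refl
  iff⇒≡ {false} {false} _ _ = refl

-- Existence of a tangle prefix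

NonEmpty : (Fin i → Bool) → (Fin j → Bool) → Set
NonEmpty p q = (∃ λ u → p u ≡ true) ⊎ (∃ λ w → q w ≡ true)

¬constant⇒nonEmpty : (p : Fin i → Bool) (q : Fin j → Bool) → ¬ Constant p q → NonEmpty p q
¬constant⇒nonEmpty p q ¬c with any? (λ u → p u Bool.≟ true) | any? (λ w → q w Bool.≟ true)
... | yes h | _     = inj₁ h
... | no _  | yes h = inj₂ h
... | no h  | no k  = contradiction (false , (λ u → ¬-not λ e → h (u , e)) , (λ w → ¬-not λ e → k (w , e))) ¬c

¬constant⇒smaller : (P : Subset i) (Q : Subset j) → ¬ Constant (lookup P) (lookup Q) → ∣ P ∣ ℕ.+ ∣ Q ∣ ℕ.< i ℕ.+ j
¬constant⇒smaller P Q ¬c with any? (λ u → lookup P u Bool.≟ false) | any? (λ w → lookup Q w Bool.≟ false)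
... | yes (u , h) | _           = ℕ.+-mono-<-≤ (lookup-false⇒∣p∣<n P u h) (∣p∣≤n Q)
... | no _        | yes (w , h) = ℕ.+-mono-≤-< (∣p∣≤n P) (lookup-false⇒∣p∣<n Q w h)
... | no h        | no k        = contradiction (true , (λ u → ¬-not λ e → h (u , e)) , (λ w → ¬-not λ e → k (w , e))) ¬c

indecomposable-or-split : (E : EdgeSet i j) →
  Indecomposable E ⊎ ∃₂ λ P Q → Prefix E P Q × ¬ Constant (lookup P) (lookup Q)
indecomposable-or-split E
  with anySubset? (λ P → anySubset? λ Q → isPrefix? E (lookup P) (lookup Q) ×-dec ¬? (constant? (lookup P) (lookup Q)))
... | yes (P , Q , h) = inj₂ (P , Q , h)
-- The finite search ran over subsets, so an arbitrary prefix given by functions is first tabulated.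
... | no none         = inj₁ λ p q pre →
  let P = tabulate p
      Q = tabulate q
      pre′ : Prefix E P Q
      pre′ u w = subst₂ (λ a b → a ≡ b ⊎ edge E u w ≡ a) (sym (lookup∘tabulate p u)) (sym (lookup∘tabulate q w)) (pre u w)
      (b , p≡b , q≡b) = decidable-stable (constant? (lookup P) (lookup Q)) λ ¬c → none (P , Q , pre′ , ¬c)
  in b , (λ u → trans (sym (lookup∘tabulate p u)) (p≡b u)) , (λ w → trans (sym (lookup∘tabulate q w)) (q≡b w))

extend-nonEmpty : (A : Subset i) (C : Subset j) → ∀ {P Q} → NonEmpty (lookup P) (lookup Q) →
                  NonEmpty (lookup (extend A P)) (lookup (extend C Q))
extend-nonEmpty A C {P} (inj₁ (u , h)) = inj₁ (embed A u , trans (lookup-extend-embed A P u) h)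
extend-nonEmpty A C {Q = Q} (inj₂ (w , h)) = inj₂ (embed C w , trans (lookup-extend-embed C Q w) h)

-- Descent on the number of vertices: a non-trivial prefix of the induced graph is neither empty nor
-- full, so it extends to a non-empty, strictly smaller prefix of `E`.
minimalPrefix : (E : EdgeSet i j) → ∀ A C → Prefix E A C → NonEmpty (lookup A) (lookup C) →
                ∃₂ λ A C → Prefix E A C × NonEmpty (lookup A) (lookup C) × Indecomposable (induced A C E)
minimalPrefix E A C = go A C (<-wellFounded _)
  where
  go : ∀ A C → Acc ℕ._<_ (∣ A ∣ ℕ.+ ∣ C ∣) → Prefix E A C → NonEmpty (lookup A) (lookup C) →
       ∃₂ λ A C → Prefix E A C × NonEmpty (lookup A) (lookup C) × Indecomposable (induced A C E)
  go A C (acc rec) pre ne with indecomposable-or-split (induced A C E)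
  ... | inj₁ ind = A , C , pre , ne , ind
  ... | inj₂ (P , Q , pre′ , ¬c) = go (extend A P) (extend C Q)
    (rec (subst₂ (λ a c → a ℕ.+ c ℕ.< ∣ A ∣ ℕ.+ ∣ C ∣) (sym (∣extend∣ A P)) (sym (∣extend∣ C Q)) (¬constant⇒smaller P Q ¬c)))
    (prefix-extend E A C {P} {Q} pre pre′)
    (extend-nonEmpty A C {P} {Q} (¬constant⇒nonEmpty (lookup P) (lookup Q) ¬c))

-- Descent starts from the full prefix, which `vertex` makes non-empty. The indecomposable prefix
-- reached meets both classes: (A , ∅) would give a full row and (∅ , C) an empty column.
tanglePrefix-exists : (E : EdgeSet i j) → Fin i ⊎ Fin j →
                      (∀ u → ¬ FullRow E u) → (∀ w → ¬ EmptyColumn E w) →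
                      ∃₂ (TanglePrefix E)
tanglePrefix-exists {i} {j} E vertex ¬row ¬column =
  let (A , C , pre , ne , ind) = minimalPrefix E ⊤ ⊤
        (λ u w → inj₁ (trans (lookup-replicate u true) (sym (lookup-replicate w true))))
        (case vertex of λ { (inj₁ u) → inj₁ (u , lookup-replicate u true)
                          ; (inj₂ w) → inj₂ (w , lookup-replicate w true) })
      (u , w) = vertices A C pre ne
  in A , C , pre , indecomposable⇒tangle u w ind
  where
  vertices : ∀ A C → Prefix E A C → NonEmpty (lookup A) (lookup C) → Fin ∣ A ∣ × Fin ∣ C ∣
  vertices A C pre ne with any? (λ u → lookup A u Bool.≟ true) | any? (λ w → lookup C w Bool.≟ true)
  ... | yes (u , u∈A) | yes (w , w∈C) = index A u∈A , index C w∈C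
    where
    index : (A : Subset n) → ∀ {x} → lookup A x ≡ true → Fin ∣ A ∣
    index A x∈A with inImage A x∈A
    ... | embedded y = y
  ... | yes (u , u∈A) | no ¬w = contradiction
    (λ w → prefix⇒edge E pre u∈A (¬-not λ w∈C → ¬w (w , w∈C))) (¬row u)
  ... | no ¬u | yes (w , w∈C) = contradiction
    (λ u → prefix⇒nonedge E pre (¬-not λ u∈A → ¬u (u , u∈A)) w∈C) (¬column w)
  ... | no ¬u | no ¬w = case ne of λ { (inj₁ h) → contradiction h ¬u ; (inj₂ h) → contradiction h ¬w }

-- Sums over lists and subsets

+-congˡ : ∀ a {b c} → b ≡ c → a ℤ.+ b ≡ a ℤ.+ c
+-congˡ a = cong (λ b → a ℤ.+ b)

sumOver : List X → (X → ℤ) → ℤ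
sumOver []       f = 0ℤ
sumOver (x ∷ xs) f = f x ℤ.+ sumOver xs f

sum-cong : (xs : List X) → ∀ {f g} → (∀ x → f x ≡ g x) → sumOver xs f ≡ sumOver xs g
sum-cong []       f≗g = refl
sum-cong (x ∷ xs) f≗g = cong₂ ℤ._+_ (f≗g x) (sum-cong xs f≗g)

sum-zero : (xs : List X) → sumOver xs (const 0ℤ) ≡ 0ℤ
sum-zero []       = refl
sum-zero (x ∷ xs) = trans (ℤ.+-identityˡ _) (sum-zero xs)

sum-+ : (xs : List X) → ∀ f g → sumOver xs (λ x → f x ℤ.+ g x) ≡ sumOver xs f ℤ.+ sumOver xs g
sum-+ []       f g = refl
sum-+ (x ∷ xs) f g = trans (+-congˡ (f x ℤ.+ g x) (sum-+ xs f g)) (interchange (f x) (g x) (sumOver xs f) (sumOver xs g))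
  where
  interchange : ∀ a b c d → (a ℤ.+ b) ℤ.+ (c ℤ.+ d) ≡ (a ℤ.+ c) ℤ.+ (b ℤ.+ d)
  interchange = solve-∀

*-sum : (xs : List X) → ∀ c f → c ℤ.* sumOver xs f ≡ sumOver xs (λ x → c ℤ.* f x)
*-sum []       c f = ℤ.*-zeroʳ c
*-sum (x ∷ xs) c f = trans (ℤ.*-distribˡ-+ c (f x) _) (+-congˡ (c ℤ.* f x) (*-sum xs c f))

sum-neg : (xs : List X) → ∀ f → sumOver xs (λ x → ℤ.- f x) ≡ ℤ.- sumOver xs f
sum-neg []       f = refl
sum-neg (x ∷ xs) f = trans (+-congˡ (ℤ.- f x) (sum-neg xs f)) (sym (ℤ.neg-distrib-+ (f x) (sumOver xs f)))

sum-swap : (xs : List X) (ys : List Y) (f : X → Y → ℤ) →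
           sumOver xs (λ x → sumOver ys (f x)) ≡ sumOver ys (λ y → sumOver xs (λ x → f x y))
sum-swap []       ys f = sym (sum-zero ys)
sum-swap (x ∷ xs) ys f = trans (+-congˡ (sumOver ys (f x)) (sum-swap xs ys f)) (sym (sum-+ ys (f x) _))

sum-++ : (xs ys : List X) → ∀ f → sumOver (xs ++ ys) f ≡ sumOver xs f ℤ.+ sumOver ys f
sum-++ []       ys f = sym (ℤ.+-identityˡ _)
sum-++ (x ∷ xs) ys f = trans (+-congˡ (f x) (sum-++ xs ys f)) (sym (ℤ.+-assoc (f x) (sumOver xs f) (sumOver ys f)))

sum-map : (h : X → Y) (xs : List X) → ∀ f → sumOver (List.map h xs) f ≡ sumOver xs (f ∘ h)
sum-map h []       f = refl
sum-map h (x ∷ xs) f = +-congˡ (f (h x)) (sum-map h xs f)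

sum-cartesianProductWith : (h : X → Y → Z) (xs : List X) (ys : List Y) → ∀ f →
  sumOver (cartesianProductWith h xs ys) f ≡ sumOver xs (λ x → sumOver ys (λ y → f (h x y)))
sum-cartesianProductWith h []       ys f = refl
sum-cartesianProductWith h (x ∷ xs) ys f = trans (sum-++ (List.map (h x) ys) _ f)
  (cong₂ ℤ._+_ (sum-map (h x) ys f) (sum-cartesianProductWith h xs ys f))

subsets : ∀ n → List (Subset n)
subsets = vecsOver bools

sum-subsets : ∀ n f → sumOver (subsets (suc n)) f ≡
              sumOver (subsets n) (f ∘ (true ∷_)) ℤ.+ sumOver (subsets n) (f ∘ (false ∷_))
sum-subsets n f = trans (sum-cartesianProductWith _∷_ bools (subsets n) f) (+-congˡ (sumOver (subsets n) (f ∘ (true ∷_))) (ℤ.+-identityʳ _))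

sum-single : (A₀ : Subset n) → ∀ {f} → (∀ A → A ≢ A₀ → f A ≡ 0ℤ) → sumOver (subsets n) f ≡ f A₀
sum-single []          f≡0 = ℤ.+-identityʳ _
sum-single {suc n} (true  ∷ A₀) {f} f≡0 = trans (sum-subsets n f) (trans (cong₂ ℤ._+_
  (sum-single A₀ λ A A≢A₀ → f≡0 (true ∷ A) (A≢A₀ ∘ ∷-injectiveʳ))
  (trans (sum-cong (subsets n) (λ A → f≡0 (false ∷ A) λ ())) (sum-zero (subsets n))))
  (ℤ.+-identityʳ _))
sum-single {suc n} (false ∷ A₀) {f} f≡0 = trans (sum-subsets n f) (trans (cong₂ ℤ._+_
  (trans (sum-cong (subsets n) (λ A → f≡0 (true ∷ A) λ ())) (sum-zero (subsets n)))
  (sum-single A₀ λ A A≢A₀ → f≡0 (false ∷ A) (A≢A₀ ∘ ∷-injectiveʳ)))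
  (ℤ.+-identityˡ _))

-- Indicators

indicator : Dec P → ℤ
indicator P? = if does P? then 1ℤ else 0ℤ

indicator-true : (P? : Dec P) → P → indicator P? ≡ 1ℤ
indicator-true (yes _) _ = refl
indicator-true (no ¬p) p = contradiction p ¬p

indicator-false : (P? : Dec P) → ¬ P → indicator P? ≡ 0ℤ
indicator-false (yes p) ¬p = contradiction p ¬p
indicator-false (no _)  _  = refl

indicator-cong : (P? : Dec P) (Q? : Dec Q) → (P → Q) → (Q → P) → indicator P? ≡ indicator Q?
indicator-cong (yes p) Q? f g = sym (indicator-true Q? (f p))
indicator-cong (no ¬p) Q? f g = sym (indicator-false Q? (¬p ∘ g))

indicator-× : (P? : Dec P) (Q? : Dec Q) → indicator (P? ×-dec Q?) ≡ indicator P? ℤ.* indicator Q?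
indicator-× (yes _) (yes _) = refl
indicator-× (yes _) (no _)  = refl
indicator-× (no _)  _       = refl

length-filter : {P : X → Set} (P? : ∀ x → Dec (P x)) (xs : List X) →
                + length (filter P? xs) ≡ sumOver xs (λ x → indicator (P? x))
length-filter P? []       = refl
length-filter P? (x ∷ xs) with P? x
... | yes _ = trans (ℤ.pos-+ 1 _) (+-congˡ 1ℤ (length-filter P? xs))
... | no _  = trans (length-filter P? xs) (sym (ℤ.+-identityˡ _))

-- Counting graphs with a given prefix

-- The condition that a prefix `(A , C)` imposes on the neighbourhood `r` of one lower vertex, where
-- `a` tells whether that vertex lies in `A`.
RowFits : Bool → Subset j → Subset j → Set
RowFits a C r = ∀ w → a ≡ lookup C w ⊎ lookup r w ≡ a

rowFits? : ∀ a (C r : Subset j) → Dec (RowFits a C r)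
rowFits? a C r = all? λ w → (a Bool.≟ lookup C w) ⊎-dec (lookup r w Bool.≟ a)

rowFits-skip : ∀ a c b (C r : Subset j) → a ≡ c ⊎ b ≡ a →
               indicator (rowFits? a (c ∷ C) (b ∷ r)) ≡ indicator (rowFits? a C r)
rowFits-skip a c b C r fit = indicator-cong (rowFits? a (c ∷ C) (b ∷ r)) (rowFits? a C r)
  (λ h → h ∘ suc) (λ h → ∀-cons fit h)

-- The row of a vertex in `A` is forced to be `true` outside `C` and is free on `C`, so each row on
-- `C` arises exactly once.
sum-rows-inside : (C : Subset j) (f : Subset ∣ C ∣ → ℤ) →
  sumOver (subsets j) (λ r → indicator (rowFits? true C r) ℤ.* f (restrict C r)) ≡ sumOver (subsets ∣ C ∣) f
sum-rows-inside [] f = cong (ℤ._+ 0ℤ) (ℤ.*-identityˡ (f []))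
sum-rows-inside {suc j} (true ∷ C) f = trans (sum-subsets j _) (trans
  (cong₂ ℤ._+_
    (trans (sum-cong (subsets j) λ r → cong (ℤ._* f (true ∷ restrict C r)) (rowFits-skip true true true C r (inj₁ refl)))
           (sum-rows-inside C (f ∘ (true ∷_))))
    (trans (sum-cong (subsets j) λ r → cong (ℤ._* f (false ∷ restrict C r)) (rowFits-skip true true false C r (inj₁ refl)))
           (sum-rows-inside C (f ∘ (false ∷_)))))
  (sym (sum-subsets ∣ C ∣ f)))
sum-rows-inside {suc j} (false ∷ C) f = trans (sum-subsets j _) (trans
  (cong₂ ℤ._+_
    (trans (sum-cong (subsets j) λ r → cong (ℤ._* f (restrict C r)) (rowFits-skip true false true C r (inj₂ refl)))
           (sum-rows-inside C f))
    (trans (sum-cong (subsets j) λ r → cong (ℤ._* f (restrict C r))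
             (indicator-false (rowFits? true (false ∷ C) (false ∷ r)) λ h → case h zero of λ { (inj₁ ()) ; (inj₂ ()) }))
           (sum-zero (subsets j))))
  (ℤ.+-identityʳ _))

-- The row of a vertex outside `A` is forced to be `false` on `C` and is free elsewhere. The induced
-- graph drops this row, so the summand `x` does not depend on it.
sum-rows-outside : (C : Subset j) (x : ℤ) →
  sumOver (subsets j) (λ r → indicator (rowFits? false C r) ℤ.* x) ≡ + (2 ℕ.^ ∣ ∁ C ∣) ℤ.* x
sum-rows-outside [] x = ℤ.+-identityʳ _
sum-rows-outside {suc j} (true ∷ C) x = trans (sum-subsets j _) (trans
  (cong₂ ℤ._+_
    (trans (sum-cong (subsets j) λ r → cong (ℤ._* x)
             (indicator-false (rowFits? false (true ∷ C) (true ∷ r)) λ h → case h zero of λ { (inj₁ ()) ; (inj₂ ()) }))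
           (sum-zero (subsets j)))
    (trans (sum-cong (subsets j) λ r → cong (ℤ._* x) (rowFits-skip false true false C r (inj₂ refl)))
           (sum-rows-outside C x)))
  (ℤ.+-identityˡ _))
sum-rows-outside {suc j} (false ∷ C) x = trans (sum-subsets j _) (trans
  (cong₂ ℤ._+_ (half true) (half false))
  (trans (double (+ (2 ℕ.^ ∣ ∁ C ∣)) x) (cong (ℤ._* x) (sym (ℤ.pos-* 2 (2 ℕ.^ ∣ ∁ C ∣))))))
  where
  half : ∀ b → sumOver (subsets j) (λ r → indicator (rowFits? false (false ∷ C) (b ∷ r)) ℤ.* x) ≡
               + (2 ℕ.^ ∣ ∁ C ∣) ℤ.* x
  half b = trans (sum-cong (subsets j) λ r → cong (ℤ._* x) (rowFits-skip false false b C r (inj₁ refl)))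
                 (sum-rows-outside C x)
  double : ∀ a x → a ℤ.* x ℤ.+ a ℤ.* x ≡ (+ 2) ℤ.* a ℤ.* x
  double = solve-∀

prefix? : (E : EdgeSet i j) → ∀ A C → Dec (Prefix E A C)
prefix? E A C = isPrefix? E (lookup A) (lookup C)

prefix-∷ : ∀ a (A : Subset i) (C r : Subset j) (E : EdgeSet i j) →
           indicator (prefix? (r ∷ E) (a ∷ A) C) ≡ indicator (rowFits? a C r) ℤ.* indicator (prefix? E A C)
prefix-∷ a A C r E = trans
  (indicator-cong (prefix? (r ∷ E) (a ∷ A) C) (rowFits? a C r ×-dec prefix? E A C)
    (λ h → h zero , h ∘ suc) (λ (h , k) → ∀-cons h k))
  (indicator-× (rowFits? a C r) (prefix? E A C))

-- A graph with prefix (A , C) is determined by the graphs induced on (A , C)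
-- and on its complement, which are arbitrary.
sum-prefix : (A : Subset i) (C : Subset j) (f : EdgeSet ∣ A ∣ ∣ C ∣ → ℤ) →
  sumOver (edgeSets i j) (λ E → indicator (prefix? E A C) ℤ.* f (induced A C E)) ≡
  + (2 ℕ.^ (∣ ∁ A ∣ ℕ.* ∣ ∁ C ∣)) ℤ.* sumOver (edgeSets ∣ A ∣ ∣ C ∣) f
sum-prefix [] C f = trans (cong (ℤ._+ 0ℤ) (ℤ.*-identityˡ (f []))) (sym (ℤ.*-identityˡ _))
sum-prefix {suc i} {j} (a ∷ A) C f = trans
  (sum-cartesianProductWith _∷_ (subsets j) (edgeSets i j) _)
  (trans (sum-cong (subsets j) λ r → trans
    (sum-cong (edgeSets i j) λ E → trans
      (cong (ℤ._* f (induced (a ∷ A) C (r ∷ E))) (prefix-∷ a A C r E))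
      (ℤ.*-assoc (indicator (rowFits? a C r)) _ _))
    (sym (*-sum (edgeSets i j) (indicator (rowFits? a C r)) _)))
  (byRow a f))
  where
  -- A vertex of `A` adds a row to the induced graph, any other vertex a factor 2^|∁ C|.
  byRow : ∀ a (f : EdgeSet ∣ a ∷ A ∣ ∣ C ∣ → ℤ) →
    sumOver (subsets j) (λ r → indicator (rowFits? a C r) ℤ.*
      sumOver (edgeSets i j) (λ E → indicator (prefix? E A C) ℤ.* f (induced (a ∷ A) C (r ∷ E)))) ≡
    + (2 ℕ.^ (∣ ∁ (a ∷ A) ∣ ℕ.* ∣ ∁ C ∣)) ℤ.* sumOver (edgeSets ∣ a ∷ A ∣ ∣ C ∣) f
  byRow true f = trans
    (sum-cong (subsets j) λ r → cong (indicator (rowFits? true C r) ℤ.*_)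
      (sum-prefix A C (λ H → f (restrict C r ∷ H))))
    (trans (sum-rows-inside C λ r → 2^ ℤ.* sumOver (edgeSets ∣ A ∣ ∣ C ∣) (λ H → f (r ∷ H)))
    (trans (sym (*-sum (subsets ∣ C ∣) 2^ _))
    (cong (2^ ℤ.*_) (sym (sum-cartesianProductWith _∷_ (subsets ∣ C ∣) (edgeSets ∣ A ∣ ∣ C ∣) f)))))
    where 2^ = + (2 ℕ.^ (∣ ∁ A ∣ ℕ.* ∣ ∁ C ∣))
  byRow false f = trans
    (sum-cong (subsets j) λ r → cong (indicator (rowFits? false C r) ℤ.*_) (sum-prefix A C f))
    (trans (sum-rows-outside C (+ (2 ℕ.^ (∣ ∁ A ∣ ℕ.* ∣ ∁ C ∣)) ℤ.* S))
    (trans (sym (ℤ.*-assoc (+ (2 ℕ.^ ∣ ∁ C ∣)) _ S))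
    (cong (ℤ._* S) (trans (sym (ℤ.pos-* (2 ℕ.^ ∣ ∁ C ∣) _))
      (cong +_ (sym (ℕ.^-distribˡ-+-* 2 ∣ ∁ C ∣ (∣ ∁ A ∣ ℕ.* ∣ ∁ C ∣))))))))
    where S = sumOver (edgeSets ∣ A ∣ ∣ C ∣) f

-- Summing over the prefixes of a graph

sign : ℕ → ℤ
sign n = -1ℤ ℤ.^ n

-- This is the alternating sum over all subsets of the set where `D` holds. If `D zero` holds, the
-- subsets with and without `zero` cancel; otherwise only those without it remain.
sum-signs : {D : Fin n → Set} (D? : ∀ x → Dec (D x)) →
  sumOver (subsets n) (λ A → indicator (all? λ x → (lookup A x Bool.≟ true) →-dec D? x) ℤ.* sign ∣ A ∣) ≡
  indicator (all? (¬? ∘ D?))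
sum-signs {zero} D? = refl
sum-signs {suc n} {D} D? = trans (sum-subsets n _) (trans
  (cong (ℤ._+ F) (sum-cong (subsets n) with-zero))
  (by-zero (D? zero)))
  where
  sub? : ∀ A → Dec (∀ x → lookup A x ≡ true → D (suc x))
  sub? A = all? λ x → (lookup A x Bool.≟ true) →-dec D? (suc x)

  F : ℤ
  F = sumOver (subsets n) (λ A → indicator (all? λ x → (lookup (false ∷ A) x Bool.≟ true) →-dec D? x) ℤ.* sign ∣ A ∣)

  S : ℤ
  S = sumOver (subsets n) (λ A → indicator (sub? A) ℤ.* sign ∣ A ∣)

  F≡S : F ≡ S
  F≡S = sum-cong (subsets n) λ A → cong (ℤ._* sign ∣ A ∣)
    (indicator-cong (all? λ x → (lookup (false ∷ A) x Bool.≟ true) →-dec D? x) (sub? A) (λ h → h ∘ suc) (∀-cons λ ()))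

  with-zero : ∀ A → indicator (all? λ x → (lookup (true ∷ A) x Bool.≟ true) →-dec D? x) ℤ.* sign ∣ true ∷ A ∣ ≡
                    ℤ.- indicator (D? zero) ℤ.* (indicator (sub? A) ℤ.* sign ∣ A ∣)
  with-zero A = trans
    (cong (ℤ._* sign ∣ true ∷ A ∣) (trans
      (indicator-cong (all? λ x → (lookup (true ∷ A) x Bool.≟ true) →-dec D? x) (D? zero ×-dec sub? A)
        (λ h → h zero refl , h ∘ suc) (λ (h , k) → ∀-cons (const h) k))
      (indicator-× (D? zero) (sub? A))))
    (rearrange (indicator (D? zero)) (indicator (sub? A)) (sign ∣ A ∣))
    where
    rearrange : ∀ d s t → d ℤ.* s ℤ.* (-1ℤ ℤ.* t) ≡ ℤ.- d ℤ.* (s ℤ.* t)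
    rearrange = solve-∀

  by-zero : (Dz : Dec (D zero)) →
    sumOver (subsets n) (λ A → ℤ.- indicator Dz ℤ.* (indicator (sub? A) ℤ.* sign ∣ A ∣)) ℤ.+ F ≡
    indicator (all? (¬? ∘ D?))
  by-zero (yes d) = trans
    (cong₂ ℤ._+_ (sym (*-sum (subsets n) -1ℤ _)) F≡S)
    (trans (cancel S) (sym (indicator-false (all? (¬? ∘ D?)) λ h → h zero d)))
    where
    cancel : ∀ s → -1ℤ ℤ.* s ℤ.+ s ≡ 0ℤ
    cancel = solve-∀
  by-zero (no ¬d) = trans
    (cong₂ ℤ._+_ (sum-zero (subsets n)) F≡S)
    (trans (ℤ.+-identityˡ S)
    (trans (sum-signs (D? ∘ suc))
    (indicator-cong (all? (¬? ∘ D? ∘ suc)) (all? (¬? ∘ D?)) (∀-cons ¬d) (λ h → h ∘ suc))))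

-- The Kronecker delta at 0: `δ ∣ A ∣` singles out the empty set, and products of two deltas give
-- the coefficients of `𝟙`.
δ : ℕ → ℤ
δ zero    = 1ℤ
δ (suc _) = 0ℤ

δ∣A∣≡0 : (A : Subset n) → A ≢ ⊥ → δ ∣ A ∣ ≡ 0ℤ
δ∣A∣≡0 []          A≢⊥ = contradiction refl A≢⊥
δ∣A∣≡0 (true  ∷ A) A≢⊥ = refl
δ∣A∣≡0 (false ∷ A) A≢⊥ = δ∣A∣≡0 A (A≢⊥ ∘ cong (false ∷_))

sum-δ : (f : Subset n → ℤ) → sumOver (subsets n) (λ A → f A ℤ.* δ ∣ A ∣) ≡ f ⊥
sum-δ {n} f = trans
  (sum-single ⊥ λ A A≢⊥ → trans (cong (f A ℤ.*_) (δ∣A∣≡0 A A≢⊥)) (ℤ.*-zeroʳ (f A)))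
  (trans (cong (λ k → f ⊥ ℤ.* δ k) (∣⊥∣≡0 n)) (ℤ.*-identityʳ _))

fullRow? : (E : EdgeSet i j) → ∀ u → Dec (FullRow E u)
fullRow? E u = all? λ w → edge E u w Bool.≟ true

emptyColumn? : (E : EdgeSet i j) → ∀ w → Dec (EmptyColumn E w)
emptyColumn? E w = all? λ u → edge E u w Bool.≟ false

sumPairs : ∀ i j → (Subset i → Subset j → ℤ) → ℤ
sumPairs i j f = sumOver (subsets i) λ A → sumOver (subsets j) λ C → f A C

sumPairs-cong : ∀ {f g : Subset i → Subset j → ℤ} → (∀ A C → f A C ≡ g A C) → sumPairs i j f ≡ sumPairs i j g
sumPairs-cong {i} {j} f≗g = sum-cong (subsets i) λ A → sum-cong (subsets j) (f≗g A)

sumPairs-+ : ∀ (f g : Subset i → Subset j → ℤ) →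
             sumPairs i j (λ A C → f A C ℤ.+ g A C) ≡ sumPairs i j f ℤ.+ sumPairs i j g
sumPairs-+ {i} {j} f g = trans (sum-cong (subsets i) λ A → sum-+ (subsets j) (f A) (g A)) (sum-+ (subsets i) _ _)

sumPairs-neg : ∀ (f : Subset i → Subset j → ℤ) →
               sumPairs i j (λ A C → ℤ.- f A C) ≡ ℤ.- sumPairs i j f
sumPairs-neg {i} {j} f = trans (sum-cong (subsets i) λ A → sum-neg (subsets j) (f A)) (sum-neg (subsets i) _)

-- The delta leaves the pairs (A , ∅). Such a pair is a prefix iff every vertex of `A` has a full
-- row, so `sum-signs` applies.
sum-bottom-prefixes : (E : EdgeSet i j) →
  sumPairs i j (λ A C → indicator (prefix? E A C) ℤ.* (sign ∣ A ∣ ℤ.* δ ∣ C ∣)) ≡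
  indicator (all? (¬? ∘ fullRow? E))
sum-bottom-prefixes {i} {j} E = trans
  (sum-cong (subsets i) λ A → trans
    (sum-cong (subsets j) λ C → sym (ℤ.*-assoc (indicator (prefix? E A C)) _ _))
    (trans (sum-δ λ C → indicator (prefix? E A C) ℤ.* sign ∣ A ∣)
    (cong (ℤ._* sign ∣ A ∣) (indicator-cong (prefix? E A ⊥)
      (all? λ u → (lookup A u Bool.≟ true) →-dec fullRow? E u)
      (λ pre u u∈A w → prefix⇒edge E pre u∈A (lookup-replicate w false))
      (λ h → mkPrefix E (λ u w u∈A _ → h u u∈A w)
        (λ u w _ w∈⊥ → contradiction (trans (sym w∈⊥) (lookup-replicate w false)) true≢false))))))
  (sum-signs (fullRow? E))

-- Dually, (∅ , C) is a prefix iff every column of `C` is empty. The sums are exchanged so that the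
-- delta acts on the inner one.
sum-top-prefixes : (E : EdgeSet i j) →
  sumPairs i j (λ A C → indicator (prefix? E A C) ℤ.* (sign ∣ C ∣ ℤ.* δ ∣ A ∣)) ≡
  indicator (all? (¬? ∘ emptyColumn? E))
sum-top-prefixes {i} {j} E = trans
  (sum-swap (subsets i) (subsets j) λ A C → indicator (prefix? E A C) ℤ.* (sign ∣ C ∣ ℤ.* δ ∣ A ∣))
  (trans (sum-cong (subsets j) λ C → trans
    (sum-cong (subsets i) λ A → sym (ℤ.*-assoc (indicator (prefix? E A C)) _ _))
    (trans (sum-δ λ A → indicator (prefix? E A C) ℤ.* sign ∣ C ∣)
    (cong (ℤ._* sign ∣ C ∣) (indicator-cong (prefix? E ⊥ C)
      (all? λ w → (lookup C w Bool.≟ true) →-dec emptyColumn? E w)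
      (λ pre w w∈C u → prefix⇒nonedge E pre (lookup-replicate u false) w∈C)
      (λ h → mkPrefix E
        (λ u w u∈⊥ _ → contradiction (trans (sym u∈⊥) (lookup-replicate u false)) true≢false)
        (λ u w _ w∈C → h w w∈C u))))))
  (sum-signs (emptyColumn? E)))

sum-empty-prefix : (E : EdgeSet i j) →
  sumPairs i j (λ A C → indicator (prefix? E A C) ℤ.* (δ ∣ A ∣ ℤ.* δ ∣ C ∣)) ≡ 1ℤ
sum-empty-prefix {i} {j} E = trans
  (sum-cong (subsets i) λ A → trans
    (sum-cong (subsets j) λ C → sym (ℤ.*-assoc (indicator (prefix? E A C)) _ _))
    (sum-δ λ C → indicator (prefix? E A C) ℤ.* δ ∣ A ∣))
  (trans (sum-δ λ A → indicator (prefix? E A ⊥))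
  (indicator-true (prefix? E ⊥ ⊥) λ u w → inj₁ (trans (lookup-replicate u false) (sym (lookup-replicate w false)))))

tanglePrefix? : (E : EdgeSet i j) → ∀ A C → Dec (TanglePrefix E A C)
tanglePrefix? E A C = prefix? E A C ×-dec isTangle? (induced A C E)

tanglePrefixes : EdgeSet i j → ℤ
tanglePrefixes {i} {j} E = sumPairs i j λ A C → indicator (tanglePrefix? E A C)

tanglePrefixes≡0 : (E : EdgeSet i j) → (∀ {A C} → ¬ TanglePrefix E A C) → tanglePrefixes E ≡ 0ℤ
tanglePrefixes≡0 {i} {j} E none = trans
  (sum-cong (subsets i) λ A → trans
    (sum-cong (subsets j) λ C → indicator-false (tanglePrefix? E A C) (none {A} {C}))
    (sum-zero (subsets j)))
  (sum-zero (subsets i))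

tanglePrefixes≡1 : (E : EdgeSet i j) → ∃₂ (TanglePrefix E) → tanglePrefixes E ≡ 1ℤ
tanglePrefixes≡1 {i} {j} E (A₀ , C₀ , t₀) = trans
  (sum-single A₀ λ A A≢A₀ → trans
    (sum-cong (subsets j) λ C → indicator-false (tanglePrefix? E A C) λ t →
      A≢A₀ (proj₁ (tanglePrefix-unique E {A} {C} {A₀} {C₀} t t₀)))
    (sum-zero (subsets j)))
  (trans (sum-single C₀ λ C C≢C₀ → indicator-false (tanglePrefix? E A₀ C) λ t →
      C≢C₀ (proj₂ (tanglePrefix-unique E {A₀} {C} {A₀} {C₀} t t₀)))
  (indicator-true (tanglePrefix? E A₀ C₀) t₀))

-- Exactly one of three things happens in a graph with a vertex: some row is
-- full, some column is empty, or there is a (unique) tangle prefix.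
prefix-trichotomy : (E : EdgeSet i j) → Fin i ⊎ Fin j →
  indicator (all? (¬? ∘ fullRow? E)) ℤ.+ indicator (all? (¬? ∘ emptyColumn? E)) ℤ.- 1ℤ ℤ.- tanglePrefixes E ≡ 0ℤ
prefix-trichotomy E vertex = by-cases (any? (fullRow? E)) (any? (emptyColumn? E))
  where
  value : ∀ {a a′ b b′ t t′} → a ≡ a′ → b ≡ b′ → t ≡ t′ → a ℤ.+ b ℤ.- 1ℤ ℤ.- t ≡ a′ ℤ.+ b′ ℤ.- 1ℤ ℤ.- t′
  value refl refl refl = refl

  by-cases : Dec (∃ (FullRow E)) → Dec (∃ (EmptyColumn E)) →
    indicator (all? (¬? ∘ fullRow? E)) ℤ.+ indicator (all? (¬? ∘ emptyColumn? E)) ℤ.- 1ℤ ℤ.- tanglePrefixes E ≡ 0ℤ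
  -- The three cases evaluate to 0 + 1 - 1 - 0, 1 + 0 - 1 - 0 and 1 + 1 - 1 - 1. A full row excludes
  -- empty columns, since the two would meet in one entry.
  by-cases (yes (u , row)) _ = value
    (indicator-false (all? (¬? ∘ fullRow? E)) λ h → h u row)
    (indicator-true (all? (¬? ∘ emptyColumn? E)) λ w column →
      contradiction (trans (sym (row w)) (column u)) true≢false)
    (tanglePrefixes≡0 E λ {A} {C} → fullRow⇒¬tanglePrefix row {A} {C})
  by-cases (no ¬row) (yes (w , column)) = value
    (indicator-true (all? (¬? ∘ fullRow? E)) λ u row → ¬row (u , row))
    (indicator-false (all? (¬? ∘ emptyColumn? E)) λ h → h w column)
    (tanglePrefixes≡0 E λ {A} {C} → emptyColumn⇒¬tanglePrefix column {A} {C})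
  by-cases (no ¬row) (no ¬column) = value
    (indicator-true (all? (¬? ∘ fullRow? E)) λ u row → ¬row (u , row))
    (indicator-true (all? (¬? ∘ emptyColumn? E)) λ w column → ¬column (w , column))
    (tanglePrefixes≡1 E
      (tanglePrefix-exists E vertex (λ u row → ¬row (u , row)) (λ w column → ¬column (w , column))))

-- The share of a single graph in i!j! times the coefficient of xⁱyʲ in e⁻ˣ + e⁻ʸ - 1 - T.
weight : EdgeSet i j → ℤ
weight {i} {j} E = sign i ℤ.* δ j ℤ.+ sign j ℤ.* δ i ℤ.- δ i ℤ.* δ j ℤ.- indicator (isTangle? E)

-- The four parts of the weight are summed over the prefixes separately, and the trichotomy makes
-- the total vanish as soon as there is a vertex.
sum-prefix-weights : (E : EdgeSet i j) →
  sumPairs i j (λ A C → indicator (prefix? E A C) ℤ.* weight (induced A C E)) ≡ δ i ℤ.* δ j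
sum-prefix-weights {i} {j} E = trans
  (sumPairs-cong λ A C → trans
    (distrib (indicator (prefix? E A C)) _ _ _ _)
    (cong (λ t → x A C ℤ.+ y A C ℤ.+ ℤ.- z A C ℤ.+ ℤ.- t)
      (sym (indicator-× (prefix? E A C) (isTangle? (induced A C E))))))
  (trans (sumPairs-+ (λ A C → x A C ℤ.+ y A C ℤ.+ ℤ.- z A C) (λ A C → ℤ.- t A C))
  (trans (cong₂ ℤ._+_
    (trans (sumPairs-+ (λ A C → x A C ℤ.+ y A C) (λ A C → ℤ.- z A C))
      (cong₂ ℤ._+_
        (trans (sumPairs-+ x y) (cong₂ ℤ._+_ (sum-bottom-prefixes E) (sum-top-prefixes E)))
        (trans (sumPairs-neg z) (cong ℤ.-_ (sum-empty-prefix E)))))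
    (sumPairs-neg t))
  (evaluate E)))
  where
  x y z t : Subset i → Subset j → ℤ
  x A C = indicator (prefix? E A C) ℤ.* (sign ∣ A ∣ ℤ.* δ ∣ C ∣)
  y A C = indicator (prefix? E A C) ℤ.* (sign ∣ C ∣ ℤ.* δ ∣ A ∣)
  z A C = indicator (prefix? E A C) ℤ.* (δ ∣ A ∣ ℤ.* δ ∣ C ∣)
  t A C = indicator (tanglePrefix? E A C)

  distrib : ∀ p a b c d → p ℤ.* (a ℤ.+ b ℤ.- c ℤ.- d) ≡
            p ℤ.* a ℤ.+ p ℤ.* b ℤ.+ ℤ.- (p ℤ.* c) ℤ.+ ℤ.- (p ℤ.* d)
  distrib = solve-∀

  evaluate : ∀ {i j} (E : EdgeSet i j) →
    indicator (all? (¬? ∘ fullRow? E)) ℤ.+ indicator (all? (¬? ∘ emptyColumn? E)) ℤ.- 1ℤ ℤ.- tanglePrefixes E ≡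
    δ i ℤ.* δ j
  -- The graph without vertices gives 1 + 1 - 1 - 0 = 1.
  evaluate {zero}  {zero}  [] = refl
  evaluate {zero}  {suc j} E  = prefix-trichotomy E (inj₂ zero)
  evaluate {suc i}         E  = prefix-trichotomy E (inj₁ zero)

sum-edgeSets-0 : ∀ i (f : EdgeSet i 0 → ℤ) c → (∀ E → f E ≡ c) → sumOver (edgeSets i 0) f ≡ c
sum-edgeSets-0 zero    f c h = trans (ℤ.+-identityʳ _) (h [])
sum-edgeSets-0 (suc i) f c h = trans
  (sum-cartesianProductWith _∷_ (subsets 0) (edgeSets i 0) f)
  (trans (ℤ.+-identityʳ _) (sum-edgeSets-0 i _ c λ E → h ([] ∷ E)))

-- i!j! times the coefficient of e⁻ˣ + e⁻ʸ - 1 - T, the candidate for the inverse of B.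
B⁻¹-coeff : ℕ → ℕ → ℤ
B⁻¹-coeff i j = sign i ℤ.* δ j ℤ.+ sign j ℤ.* δ i ℤ.- δ i ℤ.* δ j ℤ.- + τ i j

-- The part of the weight built from deltas vanishes unless a class is empty, and then there is only
-- one edge set, so summing over edge sets counts it once.
sum-weights : ∀ i j → sumOver (edgeSets i j) weight ≡ B⁻¹-coeff i j
sum-weights i j = trans (sum-+ (edgeSets i j) _ _) (cong₂ ℤ._+_
  (constants i j)
  (trans (sum-neg (edgeSets i j) (λ E → indicator (isTangle? E)))
         (cong ℤ.-_ (sym (length-filter isTangle? (edgeSets i j))))))
  where
  constants : ∀ i j → sumOver (edgeSets i j) (λ _ → sign i ℤ.* δ j ℤ.+ sign j ℤ.* δ i ℤ.- δ i ℤ.* δ j) ≡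
              sign i ℤ.* δ j ℤ.+ sign j ℤ.* δ i ℤ.- δ i ℤ.* δ j
  constants i       zero    = sum-edgeSets-0 i _ _ λ _ → refl
  constants zero    (suc j) = ℤ.+-identityʳ _
  constants (suc i) (suc j) = trans
    (sum-cong (edgeSets (suc i) (suc j)) λ _ → zeros (sign (suc i)) (sign (suc j)))
    (trans (sum-zero (edgeSets (suc i) (suc j))) (sym (zeros (sign (suc i)) (sign (suc j)))))
    where
    zeros : ∀ a b → a ℤ.* 0ℤ ℤ.+ b ℤ.* 0ℤ ℤ.- 0ℤ ≡ 0ℤ
    zeros = solve-∀

sum-edgeSets-δ : ∀ i j → sumOver (edgeSets i j) (λ _ → δ i ℤ.* δ j) ≡ δ i ℤ.* δ j
sum-edgeSets-δ zero    j = ℤ.+-identityʳ _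
sum-edgeSets-δ (suc i) j = sum-zero (edgeSets (suc i) j)

-- Double counting of pairs of a graph and one of its prefixes, weighted by the graph induced on the
-- prefix: `sum-prefix` fixes the prefix first, `sum-prefix-weights` fixes the graph first.
subset-convolution : ∀ i j →
  sumPairs i j (λ A C → + (2 ℕ.^ (∣ ∁ A ∣ ℕ.* ∣ ∁ C ∣)) ℤ.* B⁻¹-coeff ∣ A ∣ ∣ C ∣) ≡ δ i ℤ.* δ j
subset-convolution i j = begin
  sumPairs i j (λ A C → + (2 ℕ.^ (∣ ∁ A ∣ ℕ.* ∣ ∁ C ∣)) ℤ.* B⁻¹-coeff ∣ A ∣ ∣ C ∣)
    ≡⟨ sumPairs-cong {i} {j} (λ A C → trans
         (cong (+ (2 ℕ.^ (∣ ∁ A ∣ ℕ.* ∣ ∁ C ∣)) ℤ.*_) (sym (sum-weights ∣ A ∣ ∣ C ∣)))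
         (sym (sum-prefix A C weight))) ⟩
  sumPairs i j (λ A C → sumOver (edgeSets i j) (λ E → term E A C))
    ≡⟨ sum-cong (subsets i) (λ A → sum-swap (subsets j) (edgeSets i j) (λ C E → term E A C)) ⟩
  sumOver (subsets i) (λ A → sumOver (edgeSets i j) (λ E → sumOver (subsets j) (term E A)))
    ≡⟨ sum-swap (subsets i) (edgeSets i j) (λ A E → sumOver (subsets j) (term E A)) ⟩
  sumOver (edgeSets i j) (λ E → sumPairs i j (term E))
    ≡⟨ sum-cong (edgeSets i j) sum-prefix-weights ⟩
  sumOver (edgeSets i j) (λ _ → δ i ℤ.* δ j)
    ≡⟨ sum-edgeSets-δ i j ⟩
  δ i ℤ.* δ j ∎
  where
  open ≡-Reasoning
  term : EdgeSet i j → Subset i → Subset j → ℤ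
  term E A C = indicator (prefix? E A C) ℤ.* weight (induced A C E)

-- Exponential generating functions

nCk*k![n∸k]!≡n! : ∀ {n k} → k ℕ.≤ n → (n choose k) ℕ.* (k ! ℕ.* (n ∸ k) !) ≡ n !
nCk*k![n∸k]!≡n! {n} {k} k≤n = trans
  (cong (ℕ._* (k ! ℕ.* (n ∸ k) !)) (nCk≡n!/k![n-k]! k≤n))
  (m/n*n≡m {{k !* (n ∸ k) !≢0}} (k![n∸k]!∣n! k≤n))

-- Subsets are grouped by the size of their complement. Membership of the first element matches the
-- two summands of Pascal's rule; `F` is arbitrary because the induction shifts one of its
-- arguments.
binomial-sum : ∀ n (F : ℕ → ℕ → ℤ) →
  sum {suc n} (λ k → + (n choose toℕ k) ℤ.* F (toℕ k) (n ∸ toℕ k)) ≡ sumOver (subsets n) (λ A → F ∣ ∁ A ∣ ∣ A ∣)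
binomial-sum zero    F = cong (ℤ._+ 0ℤ) (ℤ.*-identityˡ (F 0 0))
binomial-sum (suc n) F = begin
  t₀ ℤ.+ sum {suc n} (λ k → + (suc n choose suc (toℕ k)) ℤ.* F (suc (toℕ k)) (n ∸ toℕ k))
    ≡⟨ +-congˡ t₀ (trans (sum-cong-≗ pascal) (∑-distrib-+ low high)) ⟩
  t₀ ℤ.+ (sum low ℤ.+ sum high)
    ≡⟨ rotate t₀ (sum low) (sum high) ⟩
  sum g ℤ.+ sum low
    ≡⟨ cong₂ ℤ._+_ (sum-init-last g) (binomial-sum n (λ k l → F (suc k) l)) ⟩
  (sum (g ∘ inject₁) ℤ.+ g (fromℕ (suc n))) ℤ.+ sumOver (subsets n) (λ A → F (suc ∣ ∁ A ∣) ∣ A ∣)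
    ≡⟨ cong (λ s → s ℤ.+ sumOver (subsets n) (λ A → F (suc ∣ ∁ A ∣) ∣ A ∣))
         (trans (+-congˡ (sum (g ∘ inject₁)) g-last) (trans (ℤ.+-identityʳ _)
           (trans (sum-cong-≗ g-init) (binomial-sum n (λ k l → F k (suc l)))))) ⟩
  sumOver (subsets n) (λ A → F ∣ ∁ A ∣ (suc ∣ A ∣)) ℤ.+ sumOver (subsets n) (λ A → F (suc ∣ ∁ A ∣) ∣ A ∣)
    ≡⟨ sum-subsets n (λ A → F ∣ ∁ A ∣ ∣ A ∣) ⟨
  sumOver (subsets (suc n)) (λ A → F ∣ ∁ A ∣ ∣ A ∣) ∎
  where
  open ≡-Reasoning
  t₀ : ℤ
  t₀ = + (suc n choose 0) ℤ.* F 0 (suc n)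

  low high : Fin (suc n) → ℤ
  low  k = + (n choose toℕ k) ℤ.* F (suc (toℕ k)) (n ∸ toℕ k)
  high k = + (n choose suc (toℕ k)) ℤ.* F (suc (toℕ k)) (n ∸ toℕ k)

  -- `g` joins `t₀` and `high` into one sum from 0 to n + 1. Its last term has the coefficient n
  -- choose n + 1, which is 0.
  g : Fin (suc (suc n)) → ℤ
  g k = + (n choose toℕ k) ℤ.* F (toℕ k) (suc n ∸ toℕ k)

  pascal : ∀ k → + (suc n choose suc (toℕ k)) ℤ.* F (suc (toℕ k)) (n ∸ toℕ k) ≡ low k ℤ.+ high k
  pascal k = trans
    (cong (λ c → + c ℤ.* F (suc (toℕ k)) (n ∸ toℕ k)) (sym (nCk+nC[k+1]≡[n+1]C[k+1] n (toℕ k))))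
    (trans (cong (ℤ._* F (suc (toℕ k)) (n ∸ toℕ k)) (ℤ.pos-+ (n choose toℕ k) (n choose suc (toℕ k))))
      (ℤ.*-distribʳ-+ (F (suc (toℕ k)) (n ∸ toℕ k)) (+ (n choose toℕ k)) (+ (n choose suc (toℕ k)))))

  rotate : ∀ a b c → a ℤ.+ (b ℤ.+ c) ≡ (a ℤ.+ c) ℤ.+ b
  rotate = solve-∀

  g-last : g (fromℕ (suc n)) ≡ 0ℤ
  g-last = trans (cong (λ k → + (n choose k) ℤ.* F k (suc n ∸ k)) (toℕ-fromℕ (suc n)))
    (cong (λ c → + c ℤ.* F (suc n) (n ∸ n)) (k>n⇒nCk≡0 {n = n} (ℕ.n<1+n n)))

  g-init : ∀ k → g (inject₁ k) ≡ + (n choose toℕ k) ℤ.* F (toℕ k) (suc (n ∸ toℕ k))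
  g-init k = trans (cong (λ k → + (n choose k) ℤ.* F k (suc n ∸ k)) (toℕ-inject₁ k))
    (cong (λ l → + (n choose toℕ k) ℤ.* F (toℕ k) l) (ℕ.+-∸-assoc 1 (toℕ≤pred[n] k)))

-- Fractions and products of exponential generating functions

fromℚᵘ-homo-+ : ∀ p q → fromℚᵘ p ℚ.+ fromℚᵘ q ≡ fromℚᵘ (p ℚᵘ.+ q)
fromℚᵘ-homo-+ p q = toℚᵘ-injective (ℚᵘ.≃-trans (toℚᵘ-homo-+ (fromℚᵘ p) (fromℚᵘ q))
  (ℚᵘ.≃-trans (ℚᵘ.+-cong (toℚᵘ-fromℚᵘ p) (toℚᵘ-fromℚᵘ q)) (ℚᵘ.≃-sym (toℚᵘ-fromℚᵘ (p ℚᵘ.+ q)))))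

fromℚᵘ-homo-* : ∀ p q → fromℚᵘ p ℚ.* fromℚᵘ q ≡ fromℚᵘ (p ℚᵘ.* q)
fromℚᵘ-homo-* p q = toℚᵘ-injective (ℚᵘ.≃-trans (toℚᵘ-homo-* (fromℚᵘ p) (fromℚᵘ q))
  (ℚᵘ.≃-trans (ℚᵘ.*-cong (toℚᵘ-fromℚᵘ p) (toℚᵘ-fromℚᵘ q)) (ℚᵘ.≃-sym (toℚᵘ-fromℚᵘ (p ℚᵘ.* q)))))

fromℚᵘ-homo‿- : ∀ p → ℚ.- fromℚᵘ p ≡ fromℚᵘ (ℚᵘ.- p)
fromℚᵘ-homo‿- p = toℚᵘ-injective (ℚᵘ.≃-trans (toℚᵘ-homo‿- (fromℚᵘ p))
  (ℚᵘ.≃-trans (ℚᵘ.-‿cong (toℚᵘ-fromℚᵘ p)) (ℚᵘ.≃-sym (toℚᵘ-fromℚᵘ (ℚᵘ.- p)))))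

-- Rationals are kept in lowest terms; passing through unnormalised ones reduces the identity to
-- cross-multiplication.
/-+ : ∀ p q d .{{_ : ℕ.NonZero d}} → p / d ℚ.+ q / d ≡ (p ℤ.+ q) / d
/-+ p q d@(suc n) = trans (fromℚᵘ-homo-+ (mkℚᵘ p n) (mkℚᵘ q n))
  (fromℚᵘ-cong {mkℚᵘ p n ℚᵘ.+ mkℚᵘ q n} {mkℚᵘ (p ℤ.+ q) n} (*≡* (trans (expand p q (+ d)) (cong ((p ℤ.+ q) ℤ.*_) (sym (ℤ.pos-* d d))))))
  where
  expand : ∀ p q d → (p ℤ.* d ℤ.+ q ℤ.* d) ℤ.* d ≡ (p ℤ.+ q) ℤ.* (d ℤ.* d)
  expand = solve-∀

/-neg : ∀ p d .{{_ : ℕ.NonZero d}} → ℚ.- (p / d) ≡ (ℤ.- p) / d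
/-neg p (suc n) = fromℚᵘ-homo‿- (mkℚᵘ p n)

/-0 : ∀ d .{{_ : ℕ.NonZero d}} → 0ℤ / d ≡ 0ℚ
/-0 (suc n) = fromℚᵘ-cong {mkℚᵘ 0ℤ n} {mkℚᵘ 0ℤ 0} (*≡* refl)

/-* : ∀ p q r m n d .{{_ : ℕ.NonZero m}} .{{_ : ℕ.NonZero n}} .{{_ : ℕ.NonZero d}} →
      p ℤ.* q ℤ.* + d ≡ r ℤ.* + (m ℕ.* n) → (p / m) ℚ.* (q / n) ≡ r / d
/-* p q r (suc m) (suc n) (suc d) eq = trans (fromℚᵘ-homo-* (mkℚᵘ p m) (mkℚᵘ q n)) (fromℚᵘ-cong {mkℚᵘ p m ℚᵘ.* mkℚᵘ q n} {mkℚᵘ r d} (*≡* eq))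

sum-/ : ∀ {n} (f : Fin n → ℤ) d .{{_ : ℕ.NonZero d}} → ℚ∑.sum (λ k → f k / d) ≡ sum f / d
sum-/ {zero}  f d = sym (/-0 d)
sum-/ {suc n} f d = trans (cong (f zero / d ℚ.+_) (sum-/ (f ∘ suc) d)) (/-+ (f zero) (sum (f ∘ suc)) d)

-- Since 1/(a!(i-a)!) is the binomial coefficient divided by i!, and likewise for j, all terms of
-- the product share the denominator i!j!.
egf-⊛-term : ∀ f g {i j a b} → a ℕ.≤ i → b ℕ.≤ j →
  egf f a b ℚ.* egf g (i ∸ a) (j ∸ b) ≡
  _/_ (+ (i choose a) ℤ.* (+ (j choose b) ℤ.* (f a b ℤ.* g (i ∸ a) (j ∸ b)))) (i ! ℕ.* j !) {{i !* j !≢0}}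
egf-⊛-term f g {i} {j} {a} {b} a≤i b≤j =
  /-* p q (+ A ℤ.* (+ B ℤ.* (p ℤ.* q))) (a ! ℕ.* b !) ((i ∸ a) ! ℕ.* (j ∸ b) !) (i ! ℕ.* j !)
    {{a !* b !≢0}} {{(i ∸ a) !* (j ∸ b) !≢0}} {{i !* j !≢0}}
    (begin
      p ℤ.* q ℤ.* + (i ! ℕ.* j !)
        ≡⟨ cong (λ d → p ℤ.* q ℤ.* d) (trans
             (cong₂ (λ x y → + (x ℕ.* y)) (sym (nCk*k![n∸k]!≡n! a≤i)) (sym (nCk*k![n∸k]!≡n! b≤j)))
             (trans (ℤ.pos-* (A ℕ.* (a ! ℕ.* a′)) (B ℕ.* (b ! ℕ.* b′)))
               (cong₂ ℤ._*_ (pos-*₃ A (a !) a′) (pos-*₃ B (b !) b′)))) ⟩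
      p ℤ.* q ℤ.* ((+ A ℤ.* (+ (a !) ℤ.* + a′)) ℤ.* (+ B ℤ.* (+ (b !) ℤ.* + b′)))
        ≡⟨ rearrange p q (+ A) (+ (a !)) (+ a′) (+ B) (+ (b !)) (+ b′) ⟩
      + A ℤ.* (+ B ℤ.* (p ℤ.* q)) ℤ.* ((+ (a !) ℤ.* + (b !)) ℤ.* (+ a′ ℤ.* + b′))
        ≡⟨ cong (λ d → + A ℤ.* (+ B ℤ.* (p ℤ.* q)) ℤ.* d) (sym (trans (ℤ.pos-* (a ! ℕ.* b !) (a′ ℕ.* b′))
             (cong₂ ℤ._*_ (ℤ.pos-* (a !) (b !)) (ℤ.pos-* a′ b′)))) ⟩
      + A ℤ.* (+ B ℤ.* (p ℤ.* q)) ℤ.* + ((a ! ℕ.* b !) ℕ.* (a′ ℕ.* b′)) ∎)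
  where
  open ≡-Reasoning
  p = f a b
  q = g (i ∸ a) (j ∸ b)
  A = i choose a
  B = j choose b
  a′ = (i ∸ a) !
  b′ = (j ∸ b) !

  pos-*₃ : ∀ x y z → + (x ℕ.* (y ℕ.* z)) ≡ + x ℤ.* (+ y ℤ.* + z)
  pos-*₃ x y z = trans (ℤ.pos-* x (y ℕ.* z)) (cong (+ x ℤ.*_) (ℤ.pos-* y z))

  rearrange : ∀ p q A a a′ B b b′ →
    p ℤ.* q ℤ.* ((A ℤ.* (a ℤ.* a′)) ℤ.* (B ℤ.* (b ℤ.* b′))) ≡
    A ℤ.* (B ℤ.* (p ℤ.* q)) ℤ.* ((a ℤ.* b) ℤ.* (a′ ℤ.* b′))
  rearrange = solve-∀

-- The labelled product: the vertices are split in all ways, the second factor living on (A , C) and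
-- the first on its complement. `binomial-sum` is applied once for each class.
egf-⊛ : ∀ f g → egf f ⊛ egf g ≈ egf λ i j → sumPairs i j λ A C → (f ∣ ∁ A ∣ ∣ ∁ C ∣) ℤ.* (g ∣ A ∣ ∣ C ∣)
egf-⊛ f g i j = begin
  (egf f ⊛ egf g) i j
    ≡⟨ ℚ∑.sum-cong-≗ {suc i} (λ a → trans
         (ℚ∑.sum-cong-≗ {suc j} λ b → egf-⊛-term f g (toℕ≤pred[n] a) (toℕ≤pred[n] b))
         (sum-/ (λ b → binom a ℤ.* row a b) (i ! ℕ.* j !))) ⟩
  ℚ∑.sum (λ a → sum (λ b → binom a ℤ.* row a b) / (i ! ℕ.* j !))
    ≡⟨ sum-/ (λ a → sum (λ b → binom a ℤ.* row a b)) (i ! ℕ.* j !) ⟩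
  sum (λ a → sum (λ b → binom a ℤ.* row a b)) / (i ! ℕ.* j !)
    ≡⟨ cong (_/ (i ! ℕ.* j !)) (sum-cong-≗ λ a → trans
         (sym (*-distribˡ-sum (binom a) (row a)))
         (cong (binom a ℤ.*_) (binomial-sum j λ b b′ → f (toℕ a) b ℤ.* g (i ∸ toℕ a) b′))) ⟩
  sum (λ a → binom a ℤ.* F (toℕ a) (i ∸ toℕ a)) / (i ! ℕ.* j !)
    ≡⟨ cong (_/ (i ! ℕ.* j !)) (binomial-sum i F) ⟩
  sumPairs i j (λ A C → (f ∣ ∁ A ∣ ∣ ∁ C ∣) ℤ.* (g ∣ A ∣ ∣ C ∣)) / (i ! ℕ.* j !) ∎
  where
  open ≡-Reasoning
  instance _ = i !* j !≢0
  binom : Fin (suc i) → ℤ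
  binom a = + (i choose toℕ a)
  row : Fin (suc i) → Fin (suc j) → ℤ
  row a b = + (j choose toℕ b) ℤ.* (f (toℕ a) (toℕ b) ℤ.* g (i ∸ toℕ a) (j ∸ toℕ b))
  F : ℕ → ℕ → ℤ
  F a a′ = sumOver (subsets j) λ C → (f a ∣ ∁ C ∣) ℤ.* (g a′ ∣ C ∣)

-- The series of the theorem

egf-δ : egf (λ i j → δ i ℤ.* δ j) ≈ 𝟙
egf-δ zero    zero    = refl
egf-δ zero    (suc j) = /-0 (0 ! ℕ.* suc j !) {{0 !* suc j !≢0}}
egf-δ (suc i) j       = /-0 (suc i ! ℕ.* j !) {{suc i !* j !≢0}}

exp[-x]≈ : exp[-x] ≈ egf λ i j → sign i ℤ.* δ j
exp[-x]≈ i zero    = cong (λ c → _/_ c (i ! ℕ.* 1) {{i !* 0 !≢0}}) (sym (ℤ.*-identityʳ (sign i)))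
exp[-x]≈ i (suc j) = cong (λ c → _/_ c (i ! ℕ.* suc j !) {{i !* suc j !≢0}}) (sym (ℤ.*-zeroʳ (sign i)))

exp[-y]≈ : exp[-y] ≈ egf λ i j → sign j ℤ.* δ i
exp[-y]≈ zero    j = cong (λ c → _/_ c (0 ! ℕ.* j !) {{0 !* j !≢0}}) (sym (ℤ.*-identityʳ (sign j)))
exp[-y]≈ (suc i) j = cong (λ c → _/_ c (suc i ! ℕ.* j !) {{suc i !* j !≢0}}) (sym (ℤ.*-zeroʳ (sign j)))

egf-⊕ : ∀ f g → egf f ⊕ egf g ≈ egf λ i j → f i j ℤ.+ g i j
egf-⊕ f g i j = /-+ (f i j) (g i j) (i ! ℕ.* j !) {{i !* j !≢0}}

egf-⊖ : ∀ f g → egf f ⊖ egf g ≈ egf λ i j → f i j ℤ.- g i j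
egf-⊖ f g i j = trans
  (cong (egf f i j ℚ.+_) (/-neg (g i j) (i ! ℕ.* j !) {{i !* j !≢0}}))
  (egf-⊕ f (λ i j → ℤ.- g i j) i j)

B⁻¹-expansion : exp[-x] ⊕ exp[-y] ⊖ 𝟙 ⊖ T-lbl ≈ egf B⁻¹-coeff
B⁻¹-expansion i j = trans
  (cong (ℚ._- T-lbl i j) (trans
    (cong₂ ℚ._-_ (trans (cong₂ ℚ._+_ (exp[-x]≈ i j) (exp[-y]≈ i j)) (egf-⊕ x y i j)) (sym (egf-δ i j)))
    (egf-⊖ (λ i j → x i j ℤ.+ y i j) z i j)))
  (egf-⊖ (λ i j → x i j ℤ.+ y i j ℤ.- z i j) (λ i j → + τ i j) i j)
  where
  x y z : ℕ → ℕ → ℤ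
  x i j = sign i ℤ.* δ j
  y i j = sign j ℤ.* δ i
  z i j = δ i ℤ.* δ j

⊖-⊖-cancel : ∀ s t → s ℚ.- (s ℚ.- t) ≡ t
⊖-⊖-cancel = solve 2 (λ s t → s :- (s :- t) := t) refl
  where open +-*-Solver

theorem4p3 : ∃ λ (B⁻¹ : Series) → (B⁻¹ IsInverseOf B-lbl) × (T-lbl ≈ exp[-x] ⊕ exp[-y] ⊖ 𝟙 ⊖ B⁻¹)
theorem4p3 = egf B⁻¹-coeff ,
  (λ i j → trans (egf-⊛ (λ i j → + (2 ℕ.^ (i ℕ.* j))) B⁻¹-coeff i j)
    (trans (cong (λ c → _/_ c (i ! ℕ.* j !) {{i !* j !≢0}}) (subset-convolution i j)) (egf-δ i j))) ,
  -- With S = e⁻ˣ + e⁻ʸ - 1 the inverse is S - T, so T = S - (S - T).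
  (λ i j → trans (sym (⊖-⊖-cancel ((exp[-x] ⊕ exp[-y] ⊖ 𝟙) i j) (T-lbl i j)))
    (cong (λ b → (exp[-x] ⊕ exp[-y] ⊖ 𝟙) i j ℚ.- b) (B⁻¹-expansion i j)))
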